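{- Let $G=(V,E)$ be a finite graph, let $A,B,C\subseteq E$ be chosen independently and uniformly at random and let $\Delta$ be the event that $A\bigtriangleup B$ and $B\bigtriangleup C$ are both eulerian. If $|E|\not\equiv 1\pmod 4$, then the event that $|A|+|B|+|C|\equiv 0$ or $1\pmod 4$ (i.e. that $\left\lfloor\frac{|A|+|B|+|C|}{2}\right\rfloor$ is even) is correlated with $\Delta$ as follows: $$\frac{\mathrm{Bias}(|A|+|B|+|C|\equiv 0,1\ (\mathrm{mod}\ 4)\mid\Delta)}{\mathrm{Bias}(|A|+|B|+|C|\equiv 0,1\ (\mathrm{mod}\ 4))}=2^{r(G)}(-1)^{n(G)}\,T(G;-1,-1).$$ If $|E|\equiv 1\pmod 4$, then $$\mathrm{Bias}(|A|+|B|+|C|\equiv 0,1\ (\mathrm{mod}\ 4))=0=\mathrm{Bias}(|A|+|B|+|C|\equiv 0,1\ (\mathrm{mod}\ 4)\mid\Delta).$$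
   Context: Graphs are finite; loops and parallel edges are permitted. A subset $A\subseteq E$ is identified with the subgraph $(V,A)$ of $G$; it is called eulerian if all its vertex degrees are even (a loop contributes 2 to the degree). $\bigtriangleup$ is symmetric difference of sets. For $A\subseteq E$, $r(A)=|V|-k(A)$, where $k(A)$ is the number of connected components of $(V,A)$; $r(G)=r(E)$ and $n(G)=|E|-r(G)$. The Tutte polynomial is $T(G;x,y)=\sum_{A\subseteq E}(x-1)^{r(E)-r(A)}(y-1)^{|A|-r(A)}$. For an event $\Sigma$, $\mathrm{Bias}(\Sigma)=\mathbb{P}(\Sigma)-\mathbb{P}(\overline{\Sigma})$ and $\mathrm{Bias}(\Sigma\mid\Delta)=\mathbb{P}(\Sigma\mid\Delta)-\mathbb{P}(\overline{\Sigma}\mid\Delta)$, where $\overline{\Sigma}$ is the complement of $\Sigma$. -}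

module Defs where

import Data.Empty as Empty
open import Data.Fin.Base using (Fin; zero; suc)
open import Data.Fin.Properties using (_≟_; _<?_; any?; all?)
open import Data.Fin.Subset
  using (Subset; inside; outside; _∈_; _∪_; _─_; ∣_∣; ⊥; ⊤)
open import Data.Fin.Subset.Properties using (_∈?_; drop-there; ∉⊥)
open import Data.Integer.Base as ℤ using (ℤ; +_; 0ℤ; 1ℤ)
open import Data.List.Base as List
  using (List; []; _∷_; _++_; length; filter; allFin; cartesianProduct)
import Data.List.Membership.Propositional as List
open import Data.List.Membership.Propositional.Properties
  using (∈-map⁺; ∈-map⁻; ∈-++⁺ˡ; ∈-++⁺ʳ; ∈-cartesianProduct⁺; ∈-filter⁺; ∈-length)
open import Data.List.Relation.Unary.Any using (here)
import Data.List.Relation.Unary.All as All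
import Data.List.Relation.Unary.AllPairs as AllPairs
open import Data.List.Relation.Unary.Unique.Propositional using (Unique)
import Data.List.Relation.Unary.Unique.Propositional.Properties as Unique
open import Data.List.Properties using (filter-none)
open import Data.Nat.Base as ℕ using (ℕ; zero; suc; _∸_; _%_; >-nonZero)
open import Data.Nat.Divisibility using (_∣_; _∣?_; divides)
import Data.Nat.Properties as ℕ
open import Data.Product.Base using (_×_; _,_; ∃; proj₁; proj₂)
open import Data.Rational.Base as ℚ using (ℚ)
import Data.Rational.Properties as ℚ
open import Data.Sum.Base using (_⊎_; inj₁; inj₂)
open import Data.Vec.Base as Vec using ([]; _∷_)
import Data.Vec.Properties as Vec
open import Function.Base using (_∘_)
open import Level using (0ℓ)
open import Relation.Binary.Core using (Rel)
open import Relation.Binary.Construct.Closure.Equivalence as Eq using (EqClosure)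
open import Relation.Binary.Construct.Closure.ReflexiveTransitive using (ε; _◅_)
open import Relation.Binary.Construct.Closure.Symmetric using (fwd; bwd)
open import Relation.Binary.Definitions using (Decidable)
open import Relation.Binary.PropositionalEquality
  using (_≡_; refl; sym; cong; subst)
open import Relation.Nullary.Decidable using (map′; ¬?; _×-dec_; _⊎-dec_)
open import Relation.Unary as Pred using (Pred)
open import Relation.Unary.Properties using (∁?; _∩?_)

-- Finite multigraphs.  The order of the two ends of an edge is
-- immaterial for every notion below; a loop has equal ends.

record Graph : Set where
  field
    #V   : ℕ
    #E   : ℕ
    ends : Fin #E → Fin #V × Fin #V

-- Connectivity in the spanning subgraph (V , A).

module _ {n : ℕ} where

  Joins : ∀ {m} → (Fin m → Fin n × Fin n) → Subset m → Rel (Fin n) 0ℓ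
  Joins ends A u v = ∃ λ e → e ∈ A × ends e ≡ (u , v)

  Connected : ∀ {m} → (Fin m → Fin n × Fin n) → Subset m → Rel (Fin n) 0ℓ
  Connected ends A = EqClosure (Joins ends A)

  -- Connectivity in (V , {0} ∪ A) in terms of that in (V , A).
  module FirstEdge {m : ℕ} (ends : Fin (suc m) → Fin n × Fin n) (A : Subset m) where

    C : Rel (Fin n) 0ℓ
    C = Connected (ends ∘ suc) A

    rfl : ∀ {u} → C u u
    rfl = Eq.reflexive _

    sy : ∀ {u v} → C u v → C v u
    sy = Eq.symmetric _

    _▸_ : ∀ {u v w} → C u v → C v w → C u w
    _▸_ = Eq.transitive _

    s t : Fin n
    s = proj₁ (ends zero)
    t = proj₂ (ends zero)

    Via : Rel (Fin n) 0ℓ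
    Via u v = C u v ⊎ (C u s × C t v) ⊎ (C u t × C s v)

    lift : ∀ {b u v} → C u v → Connected ends (b ∷ A) u v
    lift = Eq.map λ { (e , e∈A , eq) → suc e , Vec.there e∈A , eq }

    lower : ∀ {u v} → Connected ends (outside ∷ A) u v → C u v
    lower = Eq.map λ { (suc e , e∈A , eq) → e , drop-there e∈A , eq }

    via-sym : ∀ {u v} → Via u v → Via v u
    via-sym (inj₁ p)              = inj₁ (sy p)
    via-sym (inj₂ (inj₁ (p , q))) = inj₂ (inj₂ (sy q , sy p))
    via-sym (inj₂ (inj₂ (p , q))) = inj₂ (inj₁ (sy q , sy p))

    via-trans : ∀ {u v w} → Via u v → Via v w → Via u w
    via-trans (inj₁ p)              (inj₁ q)               = inj₁ (p ▸ q)
    via-trans (inj₁ p)              (inj₂ (inj₁ (q , r)))  = inj₂ (inj₁ (p ▸ q , r))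
    via-trans (inj₁ p)              (inj₂ (inj₂ (q , r)))  = inj₂ (inj₂ (p ▸ q , r))
    via-trans (inj₂ (inj₁ (p , q))) (inj₁ r)               = inj₂ (inj₁ (p , q ▸ r))
    via-trans (inj₂ (inj₁ (p , q))) (inj₂ (inj₁ (_ , r′))) = inj₂ (inj₁ (p , r′))
    via-trans (inj₂ (inj₁ (p , q))) (inj₂ (inj₂ (_ , r′))) = inj₁ (p ▸ r′)
    via-trans (inj₂ (inj₂ (p , q))) (inj₁ r)               = inj₂ (inj₂ (p , q ▸ r))
    via-trans (inj₂ (inj₂ (p , q))) (inj₂ (inj₁ (_ , r′))) = inj₁ (p ▸ r′)
    via-trans (inj₂ (inj₂ (p , q))) (inj₂ (inj₂ (_ , r′))) = inj₂ (inj₂ (p , r′))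

    joins⇒via : ∀ {u v} → Joins ends (inside ∷ A) u v → Via u v
    joins⇒via (zero  , _   , refl) = inj₂ (inj₁ (rfl , rfl))
    joins⇒via (suc e , e∈A , eq)   = inj₁ (Eq.return (e , drop-there e∈A , eq))

    connected⇒via : ∀ {u v} → Connected ends (inside ∷ A) u v → Via u v
    connected⇒via = Eq.fold
      (record { refl = inj₁ rfl ; sym = via-sym ; trans = via-trans }) joins⇒via

    via⇒connected : ∀ {u v} → Via u v → Connected ends (inside ∷ A) u v
    via⇒connected (inj₁ p)              = lift p
    via⇒connected (inj₂ (inj₁ (p , q))) = Eq.transitive _ (lift p)
      (Eq.transitive _ (Eq.return (zero , Vec.here , refl)) (lift q))
    via⇒connected (inj₂ (inj₂ (p , q))) = Eq.transitive _ (lift p)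
      (Eq.transitive _ (Eq.symmetric _ (Eq.return (zero , Vec.here , refl))) (lift q))

  open FirstEdge

  connected? : ∀ {m} (ends : Fin m → Fin n × Fin n) A → Decidable (Connected ends A)
  connected? {zero} ends [] u v = map′ (λ { refl → ε }) discrete (u ≟ v)
    where
    discrete : Connected ends [] u v → u ≡ v
    discrete ε = refl
    discrete (fwd (() , _) ◅ _)
    discrete (bwd (() , _) ◅ _)
  connected? {suc m} ends (outside ∷ A) u v =
    map′ (lift ends A) (lower ends A) (connected? (ends ∘ suc) A u v)
  connected? {suc m} ends (inside ∷ A) u v =
    map′ (via⇒connected ends A) (connected⇒via ends A)
      (u ~? v ⊎-dec (u ~? s ends A ×-dec t ends A ~? v)
              ⊎-dec (u ~? t ends A ×-dec s ends A ~? v))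
    where _~?_ = connected? (ends ∘ suc) A

-- A list of all subsets of an m-element set, each occurring once.

subsets : ∀ m → List (Subset m)
subsets zero    = [] ∷ []
subsets (suc m) = List.map (outside ∷_) (subsets m) ++ List.map (inside ∷_) (subsets m)

∈-subsets : ∀ {m} (A : Subset m) → A List.∈ subsets m
∈-subsets []            = here refl
∈-subsets (outside ∷ A) = ∈-++⁺ˡ (∈-map⁺ (outside ∷_) (∈-subsets A))
∈-subsets (inside  ∷ A) = ∈-++⁺ʳ _ (∈-map⁺ (inside ∷_) (∈-subsets A))

subsets-unique : ∀ m → Unique (subsets m)
subsets-unique zero    = All.[] AllPairs.∷ AllPairs.[]
subsets-unique (suc m) = Unique.++⁺
  (Unique.map⁺ Vec.∷-injectiveʳ (subsets-unique m))
  (Unique.map⁺ Vec.∷-injectiveʳ (subsets-unique m))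
  λ (p , q) → disjoint (∈-map⁻ _ p) (∈-map⁻ _ q)
  where
  disjoint : ∀ {B : Subset (suc m)} →
             ∃ (λ A → A List.∈ subsets m × B ≡ outside ∷ A) →
             ∃ (λ A → A List.∈ subsets m × B ≡ inside ∷ A) → Empty.⊥
  disjoint (_ , _ , refl) (_ , _ , ())

_△_ : ∀ {m} → Subset m → Subset m → Subset m
A △ B = (A ─ B) ∪ (B ─ A)

module _ (G : Graph) where
  open Graph G

  -- Each component is counted through its least vertex.
  k : Subset #E → ℕ
  k A = length (filter
    (λ v → ¬? (any? λ u → (u <? v) ×-dec connected? ends A u v)) (allFin #V))

  r : Subset #E → ℕ
  r A = #V ∸ k A

  rank nullity : ℕ
  rank    = r ⊤
  nullity = #E ∸ rank

  -- The truncated subtractions are exact: r A ≤ r ⊤ and r A ≤ ∣ A ∣.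
  -- Since 0 ^ 0 = 1, this evaluates the polynomial also at x = 1 or y = 1.
  Tutte : ℤ → ℤ → ℤ
  Tutte x y = List.foldr ℤ._+_ 0ℤ (List.map term (subsets #E))
    where
    term : Subset #E → ℤ
    term A = (x ℤ.- 1ℤ) ℤ.^ (r ⊤ ∸ r A) ℤ.* (y ℤ.- 1ℤ) ℤ.^ (∣ A ∣ ∸ r A)

  edges : Subset #E → List (Fin #E)
  edges A = filter (_∈? A) (allFin #E)

  -- A loop at v contributes to both summands.
  degree : Subset #E → Fin #V → ℕ
  degree A v = length (filter (λ e → proj₁ (ends e) ≟ v) (edges A))
         ℕ.+ length (filter (λ e → proj₂ (ends e) ≟ v) (edges A))

  Eulerian : Pred (Subset #E) 0ℓ
  Eulerian A = ∀ v → 2 ∣ degree A v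

  eulerian? : Pred.Decidable Eulerian
  eulerian? A = all? λ v → 2 ∣? degree A v

-- The uniform distribution on a duplicate-free, nonempty list of outcomes.

module Uniform {Ω : Set} (outcomes : List Ω) .{{nonEmpty : ℕ.NonZero (length outcomes)}} where

  ℙ : {P : Pred Ω 0ℓ} → Pred.Decidable P → ℚ
  ℙ P? = + length (filter P? outcomes) ℚ./ length outcomes

  ℙ[_∣_] : {P Q : Pred Ω 0ℓ} (P? : Pred.Decidable P) (Q? : Pred.Decidable Q) →
           .{{ℚ.NonZero (ℙ Q?)}} → ℚ
  ℙ[ P? ∣ Q? ] = ℙ (P? ∩? Q?) ℚ.÷ ℙ Q?

  Bias : {P : Pred Ω 0ℓ} → Pred.Decidable P → ℚ
  Bias P? = ℙ P? ℚ.- ℙ (∁? P?)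

  Bias[_∣_] : {P Q : Pred Ω 0ℓ} (P? : Pred.Decidable P) (Q? : Pred.Decidable Q) →
              .{{ℚ.NonZero (ℙ Q?)}} → ℚ
  Bias[ P? ∣ Q? ] = ℙ[ P? ∣ Q? ] ℚ.- ℙ[ ∁? P? ∣ Q? ]

  ℙ-nonZero : {P : Pred Ω 0ℓ} (P? : Pred.Decidable P) {ω : Ω} →
              ω List.∈ outcomes → P ω → ℚ.NonZero (ℙ P?)
  ℙ-nonZero P? ω∈ Pω = ℚ.pos⇒nonZero (ℙ P?) {{ℚ.normalize-pos
    (length (filter P? outcomes)) (length outcomes)
    {{nonEmpty}} {{>-nonZero (∈-length (∈-filter⁺ P? ω∈ Pω))}}}}

-- Three independent uniformly random subsets are a uniformly random triple.

Triple : ℕ → Set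
Triple m = Subset m × Subset m × Subset m

triples : ∀ m → List (Triple m)
triples m = cartesianProduct (subsets m) (cartesianProduct (subsets m) (subsets m))

∈-triples : ∀ {m} (ω : Triple m) → ω List.∈ triples m
∈-triples (A , B , C) =
  ∈-cartesianProduct⁺ (∈-subsets A) (∈-cartesianProduct⁺ (∈-subsets B) (∈-subsets C))

triples-nonEmpty : ∀ m → ℕ.NonZero (length (triples m))
triples-nonEmpty m = >-nonZero (∈-length (∈-triples {m} (⊥ , ⊥ , ⊥)))

module _ (G : Graph) where
  open Graph G
  open Uniform (triples #E) {{triples-nonEmpty #E}}

  BothEulerian : Pred (Triple #E) 0ℓ
  BothEulerian (A , B , C) = Eulerian G (A △ B) × Eulerian G (B △ C)

  bothEulerian? : Pred.Decidable BothEulerian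
  bothEulerian? (A , B , C) = eulerian? G (A △ B) ×-dec eulerian? G (B △ C)

  ZeroOrOneMod4 : Pred (Triple #E) 0ℓ
  ZeroOrOneMod4 (A , B , C) = size % 4 ≡ 0 ⊎ size % 4 ≡ 1
    where size = ∣ A ∣ ℕ.+ ∣ B ∣ ℕ.+ ∣ C ∣

  zeroOrOneMod4? : Pred.Decidable ZeroOrOneMod4
  zeroOrOneMod4? (A , B , C) = (size % 4 ℕ.≟ 0) ⊎-dec (size % 4 ℕ.≟ 1)
    where size = ∣ A ∣ ℕ.+ ∣ B ∣ ℕ.+ ∣ C ∣

  private
    ⊥△⊥ : ∀ m → ⊥ {m} △ ⊥ ≡ ⊥
    ⊥△⊥ zero    = refl
    ⊥△⊥ (suc m) = cong (outside ∷_) (⊥△⊥ m)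

    ⊥-eulerian : Eulerian G ⊥
    ⊥-eulerian v rewrite filter-none (_∈? ⊥) {allFin #E} (All.universal (λ _ → ∉⊥) _) =
      divides 0 refl

    ⊥△⊥-eulerian : Eulerian G (⊥ △ ⊥)
    ⊥△⊥-eulerian = subst (Eulerian G) (sym (⊥△⊥ #E)) ⊥-eulerian

  instance
    ℙ-bothEulerian-nonZero : ℚ.NonZero (ℙ bothEulerian?)
    ℙ-bothEulerian-nonZero =
      ℙ-nonZero bothEulerian? (∈-triples (⊥ , ⊥ , ⊥)) (⊥△⊥-eulerian , ⊥△⊥-eulerian)

  -- Bias of |A| + |B| + |C| ≡ 0, 1 (mod 4), and its bias given Δ.
  bias bias∣Δ : ℚ
  bias   = Bias zeroOrOneMod4?
  bias∣Δ = Bias[ zeroOrOneMod4? ∣ bothEulerian? ]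

{-# OPTIONS --safe #-}

-- Write the indicator of {0,1} mod 4 minus that of {2,3} as θ c = Re ((1 - i) i ^ c).  Summed over
-- all triples, θ factorises over the edges, and (1 + i) ^ 3 = - 2 (1 - i) gives (- 2) ^ |E| ρ with
-- ρ = Re ((1 - i) ^ (|E| + 1)), which vanishes iff |E| ≡ 1 (mod 4).  Given Δ, put A = X △ B and
-- C = Y △ B with X, Y eulerian: each edge contributes ± (1 - i), with sign - iff it lies in X ∪ Y, so
-- the sum is ρ Σ (-1) ^ |X ∪ Y|.  On the other side, the subgraph A contains 2 ^ (|A| - r A) eulerian
-- subgraphs, so T(-1,-1) is, up to sign and a power of 2, the sum over A of
-- (-1) ^ |A| 2 ^ |E \ A| times the number of pairs (X , Y) of eulerian subgraphs of A.  Summing over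
-- A ⊇ X ∪ Y first turns it into the same sum Σ (-1) ^ |X ∪ Y|.
module Submission where

open import Defs
import Data.Bool.Properties as Bool
open import Data.Fin.Base using (Fin; zero; suc; toℕ)
import Data.Fin.Base as Fin
open import Data.Fin.Properties using (all?; any?)
import Data.Fin.Properties as Fin
open import Data.Fin.Subset using (Subset; Side; inside; outside; _∈_; _∪_; ∣_∣; ⊤; ∁)
open import Data.Fin.Subset.Properties using (_∈?_; drop-there; ∈⊤; ∣⊤∣≡n)
open import Data.Integer.Base using (ℤ; +_; -[1+_]; -1ℤ; 0ℤ; 1ℤ; _+_; _-_; -_; _*_; _^_; ≢-nonZero)
import Data.Integer.Base as ℤ
open import Data.Integer.Properties using (+-comm; +-assoc; +-identityˡ; +-identityʳ; *-comm; *-assoc;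
  *-identityˡ; *-identityʳ; *-zeroˡ; *-zeroʳ; *-distribˡ-+; *-distribʳ-+; *-cancelˡ-≡; *-cancelʳ-≡;
  ^-distribˡ-+-*; ^-zeroˡ; neg-involutive; abs-*; i*j≡0⇒i≡0∨j≡0; i^n≡0⇒i≡0)
open import Data.Integer.Tactic.RingSolver using (solve-∀)
open import Data.List.Base as List using (List; []; _∷_; _++_; length; filter; cartesianProduct; allFin)
open import Data.List.Properties
  using (map-tabulate; filter-≐; filter-accept; filter-reject; length-filter; length-tabulate)
open import Data.Nat.Base as ℕ using (ℕ; zero; suc; _%_)
open import Data.Nat.Divisibility using (_∣?_; ∣m+n∣m⇒∣n; ∣m∣n⇒∣m+n; ∣-refl)
import Data.Nat.Properties as ℕ
open import Data.Product.Base using (Σ; ∃; _×_; _,_; proj₁; proj₂)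
open import Data.Rational.Base as ℚ using (ℚ; 0ℚ; _/_; _÷_; 1/_; NonZero)
import Data.Rational.Properties as ℚ
import Data.Rational.Unnormalised.Base as ℚᵘ
import Data.Rational.Unnormalised.Properties as ℚᵘ
open import Data.Sum.Base using (_⊎_; inj₁; inj₂)
import Data.Unit.Base as Unit
open import Data.Vec.Base using ([]; _∷_; lookup; here; there)
open import Function.Base using (_∘_; id)
open import Level using (0ℓ)
import Relation.Binary.Construct.Closure.Equivalence as Eq
open import Relation.Binary.Definitions using (tri<; tri≈; tri>)
open import Relation.Binary.PropositionalEquality
open import Relation.Nullary.Decidable using (Dec; yes; no; ¬?; _×-dec_; _⊎-dec_; _→-dec_)
open import Relation.Nullary.Negation using (¬_; contradiction)
open import Relation.Unary using (Pred; Decidable)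
open import Relation.Unary.Properties using (∁?; _∩?_)
open ≡-Reasoning

-- Pairs of eulerian subgraphs enter because `(x - 1) * (y - 1) = 4 = 2 ^ 2` at x = y = -1: up to
-- factors that depend on |A| alone, the Tutte term of A is 4 ^ (|A| - r A), the square of the
-- number of eulerian subgraphs of A. All sums stay in the integers. A Gaussian integer z is
-- represented by the real parts of its products with (1 - i) i ^ c, as a function of c:
-- multiplication by i is the step from c to c + 1, and i ^ 2 = -1 becomes a change of sign under c
-- to c + 2. The truncated exponents of `Tutte` are meaningful only if r A ≤ |A|. This is read off
-- from the count itself: 2 ^ r A times the number of eulerian subgraphs of A equals 2 ^ |A|, and
-- the number is an integer. The factor ρ may be 0, so it is kept on both sides: the biases are
-- compared by a product formula, and a quotient is formed only at the very end.

private variable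
  m n : ℕ
  P Q X Y : Set

-- Sums over all subsets

-- Opaque, so that unification can read f off ∑ f.
opaque
  ∑ : (Subset m → ℤ) → ℤ
  ∑ {zero}  f = f []
  ∑ {suc m} f = ∑ (f ∘ (outside ∷_)) + ∑ (f ∘ (inside ∷_))

  ∑-[] : (f : Subset 0 → ℤ) → ∑ f ≡ f []
  ∑-[] f = refl

  ∑-∷ : (f : Subset (suc m) → ℤ) → ∑ f ≡ ∑ (f ∘ (outside ∷_)) + ∑ (f ∘ (inside ∷_))
  ∑-∷ f = refl

∑-∷-≡ : {f : Subset (suc m) → ℤ} {x y : ℤ} →
        ∑ (f ∘ (outside ∷_)) ≡ x → ∑ (f ∘ (inside ∷_)) ≡ y → ∑ f ≡ x + y
∑-∷-≡ {f = f} p q = trans (∑-∷ f) (cong₂ _+_ p q)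

∑-cong : {f g : Subset m → ℤ} → (∀ A → f A ≡ g A) → ∑ f ≡ ∑ g
∑-cong {zero}  {f} {g} f≗g = trans (∑-[] f) (trans (f≗g []) (sym (∑-[] g)))
∑-cong {suc m} {f} {g} f≗g =
  trans (∑-∷-≡ (∑-cong (f≗g ∘ (outside ∷_))) (∑-cong (f≗g ∘ (inside ∷_)))) (sym (∑-∷ g))

+-interchange : ∀ a b c d → (a + b) + (c + d) ≡ (a + c) + (b + d)
+-interchange = solve-∀

∑-+ : (f g : Subset m → ℤ) → ∑ (λ A → f A + g A) ≡ ∑ f + ∑ g
∑-+ {zero}  f g = trans (∑-[] _) (sym (cong₂ _+_ (∑-[] f) (∑-[] g)))
∑-+ {suc m} f g = begin
  ∑ (λ A → f A + g A)      ≡⟨ ∑-∷-≡ (∑-+ f₀ g₀) (∑-+ f₁ g₁) ⟩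
  (∑ f₀ + ∑ g₀) + (∑ f₁ + ∑ g₁)  ≡⟨ +-interchange (∑ f₀) (∑ g₀) (∑ f₁) (∑ g₁) ⟩
  (∑ f₀ + ∑ f₁) + (∑ g₀ + ∑ g₁)  ≡⟨ cong₂ _+_ (∑-∷ f) (∑-∷ g) ⟨
  ∑ f + ∑ g  ∎
  where
  f₀ g₀ f₁ g₁ : Subset m → ℤ
  f₀ = f ∘ (outside ∷_)
  g₀ = g ∘ (outside ∷_)
  f₁ = f ∘ (inside ∷_)
  g₁ = g ∘ (inside ∷_)

∑-*ˡ : ∀ c (f : Subset m → ℤ) → ∑ (λ A → c * f A) ≡ c * ∑ f
∑-*ˡ {zero}  c f = trans (∑-[] _) (cong (c *_) (sym (∑-[] f)))
∑-*ˡ {suc m} c f = begin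
  ∑ (λ A → c * f A)    ≡⟨ ∑-∷-≡ (∑-*ˡ c f₀) (∑-*ˡ c f₁) ⟩
  c * ∑ f₀ + c * ∑ f₁  ≡⟨ *-distribˡ-+ c (∑ f₀) (∑ f₁) ⟨
  c * (∑ f₀ + ∑ f₁)    ≡⟨ cong (c *_) (∑-∷ f) ⟨
  c * ∑ f              ∎
  where
  f₀ f₁ : Subset m → ℤ
  f₀ = f ∘ (outside ∷_)
  f₁ = f ∘ (inside ∷_)

∑-*ʳ : ∀ c (f : Subset m → ℤ) → ∑ (λ A → f A * c) ≡ ∑ f * c
∑-*ʳ c f = trans (∑-cong λ A → *-comm (f A) c) (trans (∑-*ˡ c f) (*-comm c (∑ f)))

∑-swap : (f : Subset m → Subset n → ℤ) → ∑ (λ A → ∑ (f A)) ≡ ∑ (λ B → ∑ (λ A → f A B))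
∑-swap {zero}  f = trans (∑-[] _) (∑-cong λ B → sym (∑-[] _))
∑-swap {suc m} f = begin
  ∑ (λ A → ∑ (f A))
    ≡⟨ ∑-∷-≡ (∑-swap (f ∘ (outside ∷_))) (∑-swap (f ∘ (inside ∷_))) ⟩
  ∑ (λ B → ∑ (λ A → f (outside ∷ A) B)) + ∑ (λ B → ∑ (λ A → f (inside ∷ A) B))
    ≡⟨ ∑-+ (λ B → ∑ (λ A → f (outside ∷ A) B)) (λ B → ∑ (λ A → f (inside ∷ A) B)) ⟨
  ∑ (λ B → ∑ (λ A → f (outside ∷ A) B) + ∑ (λ A → f (inside ∷ A) B))
    ≡⟨ ∑-cong (λ B → ∑-∷ (λ A → f A B)) ⟨
  ∑ (λ B → ∑ (λ A → f A B)) ∎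

∑-product : (f : Subset m → ℤ) (g : Subset n → ℤ) → ∑ (λ A → ∑ (λ B → f A * g B)) ≡ ∑ f * ∑ g
∑-product f g = trans (∑-cong λ A → ∑-*ˡ (f A) g) (∑-*ʳ (∑ g) f)

∑-const : ∀ c → ∑ {m} (λ _ → c) ≡ (+ 2) ^ m * c
∑-const {zero}  c = trans (∑-[] _) (sym (*-identityˡ c))
∑-const {suc m} c = trans (∑-∷-≡ (∑-const {m} c) (∑-const {m} c)) (double ((+ 2) ^ m) c)
  where
  double : ∀ x c → x * c + x * c ≡ (+ 2) * x * c
  double = solve-∀

-- Translation by B permutes the subsets: at an element of B it exchanges the two halves of the sum.
∑-△ʳ : (B : Subset m) (f : Subset m → ℤ) → ∑ (λ A → f (A △ B)) ≡ ∑ f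
∑-△ʳ []            f = ∑-cong λ { [] → refl }
∑-△ʳ (outside ∷ B) f =
  trans (∑-∷-≡ (∑-△ʳ B (f ∘ (outside ∷_))) (∑-△ʳ B (f ∘ (inside ∷_)))) (sym (∑-∷ f))
∑-△ʳ (inside ∷ B)  f = begin
  ∑ (λ A → f (A △ (inside ∷ B)))
    ≡⟨ ∑-∷-≡ (∑-△ʳ B (f ∘ (inside ∷_))) (∑-△ʳ B (f ∘ (outside ∷_))) ⟩
  ∑ (f ∘ (inside ∷_)) + ∑ (f ∘ (outside ∷_))  ≡⟨ +-comm (∑ (f ∘ (inside ∷_))) _ ⟩
  ∑ (f ∘ (outside ∷_)) + ∑ (f ∘ (inside ∷_))  ≡⟨ ∑-∷ f ⟨
  ∑ f  ∎

△-comm : (A B : Subset m) → A △ B ≡ B △ A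
△-comm []            []            = refl
△-comm (outside ∷ A) (outside ∷ B) = cong (_ ∷_) (△-comm A B)
△-comm (outside ∷ A) (inside ∷ B)  = cong (_ ∷_) (△-comm A B)
△-comm (inside ∷ A)  (outside ∷ B) = cong (_ ∷_) (△-comm A B)
△-comm (inside ∷ A)  (inside ∷ B)  = cong (_ ∷_) (△-comm A B)

△-cancelʳ : (A B : Subset m) → (A △ B) △ B ≡ A
△-cancelʳ []            []            = refl
△-cancelʳ (outside ∷ A) (outside ∷ B) = cong (_ ∷_) (△-cancelʳ A B)
△-cancelʳ (outside ∷ A) (inside ∷ B)  = cong (_ ∷_) (△-cancelʳ A B)
△-cancelʳ (inside ∷ A)  (outside ∷ B) = cong (_ ∷_) (△-cancelʳ A B)
△-cancelʳ (inside ∷ A)  (inside ∷ B)  = cong (_ ∷_) (△-cancelʳ A B)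

-- The substitution X = A △ B, whose inverse is again translation by B. `f` takes two sets because
-- the summand may mention A besides A △ B.
∑-shift : (B : Subset m) (f : Subset m → Subset m → ℤ) →
          ∑ (λ A → f (A △ B) A) ≡ ∑ (λ X → f X (X △ B))
∑-shift B f = trans (∑-cong λ A → cong (f (A △ B)) (sym (△-cancelʳ A B)))
                    (∑-△ʳ B (λ X → f X (X △ B)))

-- Indicators and sums over lists

⟦_⟧ : Dec P → ℤ
⟦ yes _ ⟧ = 1ℤ
⟦ no _  ⟧ = 0ℤ

⟦⟧-cong : (p? : Dec P) (q? : Dec Q) → (P → Q) → (Q → P) → ⟦ p? ⟧ ≡ ⟦ q? ⟧
⟦⟧-cong (yes p) (yes q) _ _ = refl
⟦⟧-cong (yes p) (no ¬q) f _ = contradiction (f p) ¬q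
⟦⟧-cong (no ¬p) (yes q) _ g = contradiction (g q) ¬p
⟦⟧-cong (no ¬p) (no ¬q) _ _ = refl

⟦⟧-× : (p? : Dec P) (q? : Dec Q) → ⟦ p? ×-dec q? ⟧ ≡ ⟦ p? ⟧ * ⟦ q? ⟧
⟦⟧-× (yes _) (yes _) = refl
⟦⟧-× (yes _) (no _)  = refl
⟦⟧-× (no _)  (yes _) = refl
⟦⟧-× (no _)  (no _)  = refl

-- Written as a fold over a map, so that `Tutte` unfolds to an instance of it.
sumList : (X → ℤ) → List X → ℤ
sumList f xs = List.foldr _+_ 0ℤ (List.map f xs)

sumList-++ : (f : X → ℤ) (xs ys : List X) → sumList f (xs ++ ys) ≡ sumList f xs + sumList f ys
sumList-++ f []       ys = sym (+-identityˡ _)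
sumList-++ f (x ∷ xs) ys = trans (cong (_+_ (f x)) (sumList-++ f xs ys)) (sym (+-assoc (f x) _ _))

sumList-map : (f : X → ℤ) (g : Y → X) (ys : List Y) →
              sumList f (List.map g ys) ≡ sumList (f ∘ g) ys
sumList-map f g []       = refl
sumList-map f g (y ∷ ys) = cong (_+_ (f (g y))) (sumList-map f g ys)

sumList-cartesianProduct : (f : X × Y → ℤ) (xs : List X) (ys : List Y) →
  sumList f (cartesianProduct xs ys) ≡ sumList (λ x → sumList (λ y → f (x , y)) ys) xs
sumList-cartesianProduct f []       ys = refl
sumList-cartesianProduct f (x ∷ xs) ys = trans
  (sumList-++ f (List.map (x ,_) ys) _)
  (cong₂ _+_ (sumList-map f (x ,_) ys) (sumList-cartesianProduct f xs ys))

length-filter-sumList : {P : Pred X 0ℓ} (P? : Decidable P) (xs : List X) →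
  + length (filter P? xs) ≡ sumList (λ x → ⟦ P? x ⟧) xs
length-filter-sumList P? []       = refl
length-filter-sumList P? (x ∷ xs) with P? x
... | yes _ = cong (_+_ 1ℤ) (length-filter-sumList P? xs)
... | no  _ = trans (length-filter-sumList P? xs) (sym (+-identityˡ _))

length-sumList : (xs : List X) → + length xs ≡ sumList (λ _ → 1ℤ) xs
length-sumList []       = refl
length-sumList (x ∷ xs) = cong (_+_ 1ℤ) (length-sumList xs)

sumList-subsets : (f : Subset m → ℤ) → sumList f (subsets m) ≡ ∑ f
sumList-subsets {zero}  f = trans (+-identityʳ _) (sym (∑-[] f))
sumList-subsets {suc m} f = trans (sumList-++ f (List.map (outside ∷_) (subsets m)) _) (trans (cong₂ _+_
  (trans (sumList-map f (outside ∷_) (subsets m)) (sumList-subsets (f ∘ (outside ∷_))))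
  (trans (sumList-map f (inside ∷_) (subsets m)) (sumList-subsets (f ∘ (inside ∷_)))))
  (sym (∑-∷ f)))

sumList-triples : (f : Triple m → ℤ) →
                  sumList f (triples m) ≡ ∑ (λ A → ∑ (λ B → ∑ (λ C → f (A , B , C))))
sumList-triples {m} f = begin
  sumList f (triples m)
    ≡⟨ sumList-cartesianProduct f (subsets m) _ ⟩
  sumList (λ A → sumList (λ p → f (A , p)) (cartesianProduct (subsets m) (subsets m))) (subsets m)
    ≡⟨ sumList-subsets _ ⟩
  ∑ (λ A → sumList (λ p → f (A , p)) (cartesianProduct (subsets m) (subsets m)))
    ≡⟨ ∑-cong (λ A → trans (sumList-cartesianProduct (λ p → f (A , p)) (subsets m) (subsets m))
         (trans (sumList-subsets _) (∑-cong λ B → sumList-subsets _))) ⟩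
  ∑ (λ A → ∑ (λ B → ∑ (λ C → f (A , B , C)))) ∎

-- Powers of 1 + i and 1 - i

θ : ℕ → ℤ
θ 0             = 1ℤ
θ 1             = 1ℤ
θ (suc (suc c)) = - θ c

zeroOrOne? : ∀ c → Dec (c % 4 ≡ 0 ⊎ c % 4 ≡ 1)
zeroOrOne? c = (c % 4 ℕ.≟ 0) ⊎-dec (c % 4 ℕ.≟ 1)

θ-indicator : ∀ c → θ c ≡ ⟦ zeroOrOne? c ⟧ - ⟦ ¬? (zeroOrOne? c) ⟧
θ-indicator 0 = refl
θ-indicator 1 = refl
θ-indicator 2 = refl
θ-indicator 3 = refl
-- `(4 + c) % 4` reduces to `c % 4`, so the right-hand side is already the one for `c`.
θ-indicator (suc (suc (suc (suc c)))) = trans (neg-involutive (θ c)) (θ-indicator c)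

-- θ c = Re ((1 - i) i ^ c), and R m c = Re ((1 - i) ^ (m + 1) i ^ c).
R : ℕ → ℕ → ℤ
R zero    c = θ c
R (suc m) c = R m c - R m (suc c)

R-anti : ∀ m c → R m (2 ℕ.+ c) ≡ - R m c
R-anti zero    c = refl
R-anti (suc m) c = trans (cong₂ _-_ (R-anti m c) (R-anti m (suc c))) (lem (R m c) (R m (suc c)))
  where
  lem : ∀ a b → - a - - b ≡ - (a - b)
  lem = solve-∀

-- S n c = Re ((1 - i) (1 + i) ^ n i ^ c).
S : ℕ → ℕ → ℤ
S zero    c = θ c
S (suc n) c = S n c + S n (suc c)

S-anti : ∀ n c → S n (2 ℕ.+ c) ≡ - S n c
S-anti zero    c = refl
S-anti (suc n) c = trans (cong₂ _+_ (S-anti n c) (S-anti n (suc c))) (lem (S n c) (S n (suc c)))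
  where
  lem : ∀ a b → - a + - b ≡ - (a + b)
  lem = solve-∀

-- Splitting off one element adds the values at `c` and `c + 1`, which is a factor 1 + i. The index
-- `n` holds the factors collected so far, so that the sums over C, B and A can be evaluated in
-- turn.
∑-S : ∀ m n c → ∑ {m} (λ A → S n (c ℕ.+ ∣ A ∣)) ≡ S (m ℕ.+ n) c
∑-S zero    n c = trans (∑-[] _) (cong (S n) (ℕ.+-identityʳ c))
∑-S (suc m) n c = ∑-∷-≡ (∑-S m n c)
  (trans (∑-cong λ A → cong (S n) (ℕ.+-suc c ∣ A ∣)) (∑-S m n (suc c)))

-- (1 + i) ^ 3 = - 2 (1 - i)
S-cubes : ∀ m c → S (m ℕ.* 3) c ≡ -[1+ 1 ] ^ m * R m c
S-cubes zero    c = sym (*-identityˡ _)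
S-cubes (suc m) c = begin
  S (3 ℕ.+ m ℕ.* 3) c
    ≡⟨⟩
  ((x 0 + x 1) + (x 1 + x 2)) + ((x 1 + x 2) + (x 2 + x 3))
    ≡⟨ cong₂ (λ y z → ((x 0 + x 1) + (x 1 + y)) + ((x 1 + y) + (y + z)))
             (S-anti (m ℕ.* 3) c) (S-anti (m ℕ.* 3) (suc c)) ⟩
  ((x 0 + x 1) + (x 1 + - x 0)) + ((x 1 + - x 0) + (- x 0 + - x 1))
    ≡⟨ lem₁ (x 0) (x 1) ⟩
  -[1+ 1 ] * (x 0 - x 1)
    ≡⟨ cong₂ (λ y z → -[1+ 1 ] * (y - z)) (S-cubes m c) (S-cubes m (suc c)) ⟩
  -[1+ 1 ] * (-[1+ 1 ] ^ m * R m c - -[1+ 1 ] ^ m * R m (suc c))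
    ≡⟨ lem₂ (-[1+ 1 ] ^ m) (R m c) (R m (suc c)) ⟩
  -[1+ 1 ] ^ suc m * R (suc m) c ∎
  where
  x : ℕ → ℤ
  x j = S (m ℕ.* 3) (j ℕ.+ c)
  lem₁ : ∀ a b → ((a + b) + (b + - a)) + ((b + - a) + (- a + - b)) ≡ -[1+ 1 ] * (a - b)
  lem₁ = solve-∀
  lem₂ : ∀ p a b → -[1+ 1 ] * (p * a - p * b) ≡ -[1+ 1 ] * p * (a - b)
  lem₂ = solve-∀

∑-θ-triples : ∀ m → ∑ {m} (λ A → ∑ {m} λ B → ∑ {m} λ C → θ (∣ A ∣ ℕ.+ ∣ B ∣ ℕ.+ ∣ C ∣))
                    ≡ -[1+ 1 ] ^ m * R m 0
∑-θ-triples m = begin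
  ∑ (λ A → ∑ λ B → ∑ {m} λ C → θ (∣ A ∣ ℕ.+ ∣ B ∣ ℕ.+ ∣ C ∣))
    ≡⟨ ∑-cong (λ A → ∑-cong λ B → ∑-S m 0 (∣ A ∣ ℕ.+ ∣ B ∣)) ⟩
  ∑ (λ A → ∑ {m} λ B → S (m ℕ.+ 0) (∣ A ∣ ℕ.+ ∣ B ∣))
    ≡⟨ ∑-cong (λ A → ∑-S m (m ℕ.+ 0) ∣ A ∣) ⟩
  ∑ {m} (λ A → S (m ℕ.+ (m ℕ.+ 0)) ∣ A ∣)
    ≡⟨ ∑-S m (m ℕ.+ (m ℕ.+ 0)) 0 ⟩
  S (3 ℕ.* m) 0
    -- `suc m * 3` computes to `3 + m * 3`, so in this order each edge releases its three factors 1
    -- + i together.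
    ≡⟨ cong (λ n → S n 0) (ℕ.*-comm 3 m) ⟩
  S (m ℕ.* 3) 0
    ≡⟨ S-cubes m 0 ⟩
  -[1+ 1 ] ^ m * R m 0 ∎

-- The contribution of a fixed pair X, Y

sgn : Subset m → ℤ
sgn A = -1ℤ ^ ∣ A ∣

shift₁ : ∀ c a b d → c ℕ.+ (suc a ℕ.+ b ℕ.+ d) ≡ suc c ℕ.+ (a ℕ.+ b ℕ.+ d)
shift₁ c a b d = ℕ.+-suc c _

shift₂ : ∀ c a b d → c ℕ.+ (a ℕ.+ suc b ℕ.+ d) ≡ suc c ℕ.+ (a ℕ.+ b ℕ.+ d)
shift₂ c a b d = trans (cong (λ e → c ℕ.+ (e ℕ.+ d)) (ℕ.+-suc a b)) (shift₁ c a b d)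

shift₃ : ∀ c a b d → c ℕ.+ (a ℕ.+ b ℕ.+ suc d) ≡ suc c ℕ.+ (a ℕ.+ b ℕ.+ d)
shift₃ c a b d = trans (cong (c ℕ.+_) (ℕ.+-suc (a ℕ.+ b) d)) (ℕ.+-suc c _)

-- For each edge, the exponents of i when it is outside B and when it is in B are compared. An edge
-- in neither X nor Y gives 1 + i ^ 3 = 1 - i; an edge in exactly one of them gives i + i ^ 2 = - (1
-- - i); an edge in both gives i ^ 2 + i, the same value.
∑-θ-△ : (X Y : Subset m) (c : ℕ) →
  ∑ (λ B → θ (c ℕ.+ (∣ X △ B ∣ ℕ.+ ∣ B ∣ ℕ.+ ∣ Y △ B ∣))) ≡ sgn (X ∪ Y) * R m c
∑-θ-△ [] [] c = trans (∑-[] _) (trans (cong θ (ℕ.+-identityʳ c)) (sym (*-identityˡ _)))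
∑-θ-△ {suc m} (outside ∷ X) (outside ∷ Y) c = begin
  _ ≡⟨ ∑-∷-≡ (∑-θ-△ X Y c) (trans (∑-cong λ B → cong θ
         (trans (shift₁ c ∣ X △ B ∣ (suc ∣ B ∣) (suc ∣ Y △ B ∣))
         (trans (shift₂ (1 ℕ.+ c) ∣ X △ B ∣ ∣ B ∣ (suc ∣ Y △ B ∣))
                (shift₃ (2 ℕ.+ c) ∣ X △ B ∣ ∣ B ∣ ∣ Y △ B ∣)))) (∑-θ-△ X Y (3 ℕ.+ c))) ⟩
  s * R m c + s * R m (3 ℕ.+ c)  ≡⟨ cong (λ z → s * R m c + s * z) (R-anti m (suc c)) ⟩
  s * R m c + s * - R m (suc c)  ≡⟨ lem s (R m c) (R m (suc c)) ⟩
  s * (R m c - R m (suc c)) ∎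
  where
  s = sgn (X ∪ Y)
  lem : ∀ s p q → s * p + s * - q ≡ s * (p - q)
  lem = solve-∀
∑-θ-△ {suc m} (outside ∷ X) (inside ∷ Y) c = begin
  _ ≡⟨ ∑-∷-≡
         (trans (∑-cong λ B → cong θ (shift₃ c ∣ X △ B ∣ ∣ B ∣ ∣ Y △ B ∣)) (∑-θ-△ X Y (1 ℕ.+ c)))
         (trans (∑-cong λ B → cong θ
           (trans (shift₁ c ∣ X △ B ∣ (suc ∣ B ∣) ∣ Y △ B ∣)
                  (shift₂ (1 ℕ.+ c) ∣ X △ B ∣ ∣ B ∣ ∣ Y △ B ∣))) (∑-θ-△ X Y (2 ℕ.+ c))) ⟩
  s * R m (1 ℕ.+ c) + s * R m (2 ℕ.+ c)  ≡⟨ cong (λ z → s * R m (1 ℕ.+ c) + s * z) (R-anti m c) ⟩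
  s * R m (1 ℕ.+ c) + s * - R m c  ≡⟨ lem s (R m (suc c)) (R m c) ⟩
  -1ℤ * s * (R m c - R m (suc c)) ∎
  where
  s = sgn (X ∪ Y)
  lem : ∀ s p q → s * p + s * - q ≡ -1ℤ * s * (q - p)
  lem = solve-∀
∑-θ-△ {suc m} (inside ∷ X) (outside ∷ Y) c = begin
  _ ≡⟨ ∑-∷-≡
         (trans (∑-cong λ B → cong θ (shift₁ c ∣ X △ B ∣ ∣ B ∣ ∣ Y △ B ∣)) (∑-θ-△ X Y (1 ℕ.+ c)))
         (trans (∑-cong λ B → cong θ
           (trans (shift₂ c ∣ X △ B ∣ ∣ B ∣ (suc ∣ Y △ B ∣))
                  (shift₃ (1 ℕ.+ c) ∣ X △ B ∣ ∣ B ∣ ∣ Y △ B ∣))) (∑-θ-△ X Y (2 ℕ.+ c))) ⟩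
  s * R m (1 ℕ.+ c) + s * R m (2 ℕ.+ c)  ≡⟨ cong (λ z → s * R m (1 ℕ.+ c) + s * z) (R-anti m c) ⟩
  s * R m (1 ℕ.+ c) + s * - R m c  ≡⟨ lem s (R m (suc c)) (R m c) ⟩
  -1ℤ * s * (R m c - R m (suc c)) ∎
  where
  s = sgn (X ∪ Y)
  lem : ∀ s p q → s * p + s * - q ≡ -1ℤ * s * (q - p)
  lem = solve-∀
∑-θ-△ {suc m} (inside ∷ X) (inside ∷ Y) c = begin
  _ ≡⟨ ∑-∷-≡
         (trans (∑-cong λ B → cong θ
           (trans (shift₁ c ∣ X △ B ∣ ∣ B ∣ (suc ∣ Y △ B ∣))
                  (shift₃ (1 ℕ.+ c) ∣ X △ B ∣ ∣ B ∣ ∣ Y △ B ∣))) (∑-θ-△ X Y (2 ℕ.+ c)))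
         (trans (∑-cong λ B → cong θ (shift₂ c ∣ X △ B ∣ ∣ B ∣ ∣ Y △ B ∣)) (∑-θ-△ X Y (1 ℕ.+ c))) ⟩
  s * R m (2 ℕ.+ c) + s * R m (1 ℕ.+ c)  ≡⟨ cong (λ z → s * z + s * R m (1 ℕ.+ c)) (R-anti m c) ⟩
  s * - R m c + s * R m (1 ℕ.+ c)  ≡⟨ lem s (R m (suc c)) (R m c) ⟩
  -1ℤ * s * (R m c - R m (suc c)) ∎
  where
  s = sgn (X ∪ Y)
  lem : ∀ s p q → s * - q + s * p ≡ -1ℤ * s * (q - p)
  lem = solve-∀

-- Vanishing of the common factor

-- (1 - i) ^ 2 = - 2 i, with the factor i expressed as the shift of `c`.
R-two : ∀ m c → R (2 ℕ.+ m) c ≡ -[1+ 1 ] * R m (suc c)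
R-two m c = trans (cong (λ x → (R m c - R m (suc c)) - (R m (suc c) - x)) (R-anti m c))
                  (lem (R m c) (R m (suc c)))
  where
  lem : ∀ a b → (a - b) - (b - - a) ≡ -[1+ 1 ] * b
  lem = solve-∀

-- (1 - i) ^ 4 = - 4, so vanishing depends only on `m` modulo 4.
R-four : ∀ m c → R (4 ℕ.+ m) c ≡ -[1+ 3 ] * R m c
R-four m c = begin
  R (4 ℕ.+ m) c                          ≡⟨ R-two (2 ℕ.+ m) c ⟩
  -[1+ 1 ] * R (2 ℕ.+ m) (suc c)         ≡⟨ cong (-[1+ 1 ] *_) (R-two m (suc c)) ⟩
  -[1+ 1 ] * (-[1+ 1 ] * R m (2 ℕ.+ c))  ≡⟨ cong (λ x → -[1+ 1 ] * (-[1+ 1 ] * x)) (R-anti m c) ⟩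
  -[1+ 1 ] * (-[1+ 1 ] * - R m c)        ≡⟨ lem (R m c) ⟩
  -[1+ 3 ] * R m c                       ∎
  where
  lem : ∀ a → -[1+ 1 ] * (-[1+ 1 ] * - a) ≡ -[1+ 3 ] * a
  lem = solve-∀

-- The base value is the real part of (1 - i) ^ 2 = - 2 i.
R-zero : ∀ m → m % 4 ≡ 1 → R m 0 ≡ 0ℤ
R-zero 1 _ = refl
R-zero (suc (suc (suc (suc m)))) eq = trans (R-four m 0) (cong (-[1+ 3 ] *_) (R-zero m eq))

-- The other three residues have the base values 1, -2 and -4.
R-nonZero : ∀ m → m % 4 ≢ 1 → R m 0 ≢ 0ℤ
R-nonZero 0 _ ()
R-nonZero 1 neq _ = neq refl
R-nonZero 2 _ ()
R-nonZero 3 _ ()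
R-nonZero (suc (suc (suc (suc m)))) neq eq =
  R-nonZero m neq (*-cancelˡ-≡ -[1+ 3 ] (R m 0) 0ℤ (trans (sym (R-four m 0)) eq))

-- Products and constraint systems

∏ : (Fin m → ℤ) → Subset m → ℤ
∏ φ []            = 1ℤ
∏ φ (outside ∷ A) = ∏ (φ ∘ suc) A
∏ φ (inside ∷ A)  = φ zero * ∏ (φ ∘ suc) A

∏-cong : {φ ψ : Fin m → ℤ} → (∀ e → φ e ≡ ψ e) → ∀ A → ∏ φ A ≡ ∏ ψ A
∏-cong φ≗ψ []            = refl
∏-cong φ≗ψ (outside ∷ A) = ∏-cong (φ≗ψ ∘ suc) A
∏-cong φ≗ψ (inside ∷ A)  = cong₂ _*_ (φ≗ψ zero) (∏-cong (φ≗ψ ∘ suc) A)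

*-interchange : ∀ a b c d → (a * b) * (c * d) ≡ (a * c) * (b * d)
*-interchange = solve-∀

∏-* : (φ ψ : Fin m → ℤ) (A : Subset m) → ∏ (λ e → φ e * ψ e) A ≡ ∏ φ A * ∏ ψ A
∏-* φ ψ []            = refl
∏-* φ ψ (outside ∷ A) = ∏-* (φ ∘ suc) (ψ ∘ suc) A
∏-* φ ψ (inside ∷ A)  = trans (cong (φ zero * ψ zero *_) (∏-* (φ ∘ suc) (ψ ∘ suc) A))
  (*-interchange (φ zero) (ψ zero) (∏ (φ ∘ suc) A) (∏ (ψ ∘ suc) A))

∏-1 : (A : Subset m) → ∏ (λ _ → 1ℤ) A ≡ 1ℤ
∏-1 []            = refl
∏-1 (outside ∷ A) = ∏-1 A
∏-1 (inside ∷ A)  = trans (*-identityˡ _) (∏-1 A)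

-- Defined by recursion rather than through a decision, so that it reduces whenever `∑` splits off
-- an element.
⟦_⊆_⟧ : Subset m → Subset m → ℤ
⟦ []          ⊆ []          ⟧ = 1ℤ
⟦ outside ∷ X ⊆ _ ∷ A       ⟧ = ⟦ X ⊆ A ⟧
⟦ inside ∷ X  ⊆ outside ∷ A ⟧ = 0ℤ
⟦ inside ∷ X  ⊆ inside ∷ A  ⟧ = ⟦ X ⊆ A ⟧

∑-0 : ∑ {m} (λ _ → 0ℤ) ≡ 0ℤ
∑-0 {m} = trans (∑-const {m} 0ℤ) (*-zeroʳ ((+ 2) ^ m))

-- Expansion of the product: each element of A contributes either 1 or its factor `φ e`, and X
-- collects the elements of the second kind.
∑-⊆-∏ : (φ : Fin m → ℤ) (A : Subset m) →
        ∑ (λ X → ⟦ X ⊆ A ⟧ * ∏ φ X) ≡ ∏ (λ e → 1ℤ + φ e) A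
∑-⊆-∏ φ []            = ∑-[] _
∑-⊆-∏ φ (outside ∷ A) =
  trans (∑-∷-≡ (∑-⊆-∏ (φ ∘ suc) A) (trans (∑-cong λ X → *-zeroˡ (φ zero * ∏ (φ ∘ suc) X)) ∑-0)) (+-identityʳ _)
∑-⊆-∏ {suc m} φ (inside ∷ A)  = begin
  ∑ (λ X → ⟦ X ⊆ inside ∷ A ⟧ * ∏ φ X)
    ≡⟨ ∑-∷-≡ (∑-⊆-∏ (φ ∘ suc) A)
        (trans (∑-cong λ X → swap ⟦ X ⊆ A ⟧ (φ zero) (∏ (φ ∘ suc) X))
        (trans (∑-*ˡ (φ zero) (λ X → ⟦ X ⊆ A ⟧ * ∏ (φ ∘ suc) X))
               (cong (φ zero *_) (∑-⊆-∏ (φ ∘ suc) A)))) ⟩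
  p + φ zero * p        ≡⟨ lem (φ zero) p ⟩
  (1ℤ + φ zero) * p  ∎
  where
  p = ∏ (λ e → 1ℤ + φ (suc e)) A
  swap : ∀ a b c → a * (b * c) ≡ b * (a * c)
  swap = solve-∀
  lem : ∀ a p → p + a * p ≡ (1ℤ + a) * p
  lem = solve-∀

⟦⟧-true : (p? : Dec P) → P → ⟦ p? ⟧ ≡ 1ℤ
⟦⟧-true p? p = ⟦⟧-cong p? (yes p) id id

⟦⟧-false : (p? : Dec P) → ¬ P → ⟦ p? ⟧ ≡ 0ℤ
⟦⟧-false p? ¬p = ⟦⟧-cong p? (no ¬p) id id

everywhere? : {P : Fin m → Set} → (∀ e → Dec (P e)) → (A : Subset m) → Dec (∀ e → e ∈ A → P e)
everywhere? P? A = all? λ e → (e ∈? A) →-dec P? e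

∏-⟦⟧ : {P : Fin m → Set} (P? : ∀ e → Dec (P e)) (A : Subset m) →
       ∏ (λ e → (+ 2) * ⟦ P? e ⟧) A ≡ (+ 2) ^ ∣ A ∣ * ⟦ everywhere? P? A ⟧
∏-⟦⟧ P? [] = sym (trans (*-identityˡ ⟦ everywhere? P? [] ⟧) (⟦⟧-true (everywhere? P? []) λ ()))
∏-⟦⟧ P? (outside ∷ A) = trans (∏-⟦⟧ (P? ∘ suc) A) (cong ((+ 2) ^ ∣ A ∣ *_)
  (⟦⟧-cong (everywhere? (P? ∘ suc) A) (everywhere? P? (outside ∷ A))
    (λ { f zero () ; f (suc e) (there e∈A) → f e e∈A })
    (λ f e e∈A → f (suc e) (there e∈A))))
∏-⟦⟧ P? (inside ∷ A) = begin
  (+ 2) * ⟦ P? zero ⟧ * ∏ (λ e → (+ 2) * ⟦ P? (suc e) ⟧) A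
    ≡⟨ cong ((+ 2) * ⟦ P? zero ⟧ *_) (∏-⟦⟧ (P? ∘ suc) A) ⟩
  (+ 2) * ⟦ P? zero ⟧ * ((+ 2) ^ ∣ A ∣ * ⟦ rest? ⟧)
    ≡⟨ *-interchange (+ 2) ⟦ P? zero ⟧ ((+ 2) ^ ∣ A ∣) ⟦ rest? ⟧ ⟩
  (+ 2) * (+ 2) ^ ∣ A ∣ * (⟦ P? zero ⟧ * ⟦ rest? ⟧)
    ≡⟨ cong ((+ 2) * (+ 2) ^ ∣ A ∣ *_) (⟦⟧-× (P? zero) rest?) ⟨
  (+ 2) * (+ 2) ^ ∣ A ∣ * ⟦ P? zero ×-dec rest? ⟧
    ≡⟨ cong ((+ 2) * (+ 2) ^ ∣ A ∣ *_) (⟦⟧-cong (P? zero ×-dec rest?) (everywhere? P? (inside ∷ A))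
         (λ { (p , f) zero _ → p ; (p , f) (suc e) (there e∈A) → f e e∈A })
         (λ f → f zero here , λ e e∈A → f (suc e) (there e∈A))) ⟩
  (+ 2) * (+ 2) ^ ∣ A ∣ * ⟦ everywhere? P? (inside ∷ A) ⟧ ∎
  where rest? = everywhere? (P? ∘ suc) A

σ : Side → ℤ
σ outside = 1ℤ
σ inside  = -1ℤ

parity : ∀ d → 1ℤ + -1ℤ ^ d ≡ (+ 2) * ⟦ 2 ∣? d ⟧
parity 0             = refl
parity 1             = refl
parity (suc (suc d)) = begin
  1ℤ + -1ℤ * (-1ℤ * -1ℤ ^ d)   ≡⟨ lem (-1ℤ ^ d) ⟩
  1ℤ + -1ℤ ^ d                 ≡⟨ parity d ⟩
  (+ 2) * ⟦ 2 ∣? d ⟧           ≡⟨ cong ((+ 2) *_) (⟦⟧-cong (2 ∣? d) (2 ∣? suc (suc d))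
                                   (∣m∣n⇒∣m+n ∣-refl) (λ 2∣2+d → ∣m+n∣m⇒∣n 2∣2+d ∣-refl)) ⟩
  (+ 2) * ⟦ 2 ∣? suc (suc d) ⟧ ∎
  where
  lem : ∀ x → 1ℤ + -1ℤ * (-1ℤ * x) ≡ 1ℤ + x
  lem = solve-∀

-- The sum over all sign patterns factorises over the vertices; vertex v contributes 1 + (-1) ^ d v,
-- which is 2 or 0 according to the parity of `d v`.
∑-∏-σ : (d : Fin n → ℕ) →
        ∑ (λ U → ∏ (λ v → σ (lookup U v) ^ d v) ⊤) ≡ (+ 2) ^ n * ⟦ all? (λ v → 2 ∣? d v) ⟧
∑-∏-σ {zero}  d = trans (∑-[] _) (sym (trans (*-identityˡ ⟦ allEven? ⟧) (⟦⟧-true allEven? λ ())))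
  where allEven? = all? λ v → 2 ∣? d v
∑-∏-σ {suc n} d = begin
  ∑ (λ U → ∏ (λ v → σ (lookup U v) ^ d v) ⊤)
    ≡⟨ ∑-∷-≡ (∑-*ˡ (1ℤ ^ d zero) f) (∑-*ˡ (-1ℤ ^ d zero) f) ⟩
  1ℤ ^ d zero * ∑ f + -1ℤ ^ d zero * ∑ f
    ≡⟨ *-distribʳ-+ (∑ f) (1ℤ ^ d zero) (-1ℤ ^ d zero) ⟨
  (1ℤ ^ d zero + -1ℤ ^ d zero) * ∑ f
    ≡⟨ cong₂ _*_ (trans (cong (_+ -1ℤ ^ d zero) (^-zeroˡ (d zero))) (parity (d zero))) (∑-∏-σ (d ∘ suc)) ⟩
  (+ 2) * ⟦ 2 ∣? d zero ⟧ * ((+ 2) ^ n * ⟦ rest? ⟧)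
    ≡⟨ *-interchange (+ 2) ⟦ 2 ∣? d zero ⟧ ((+ 2) ^ n) ⟦ rest? ⟧ ⟩
  (+ 2) * (+ 2) ^ n * (⟦ 2 ∣? d zero ⟧ * ⟦ rest? ⟧)
    ≡⟨ cong ((+ 2) * (+ 2) ^ n *_) (⟦⟧-× (2 ∣? d zero) rest?) ⟨
  (+ 2) * (+ 2) ^ n * ⟦ (2 ∣? d zero) ×-dec rest? ⟧
    ≡⟨ cong ((+ 2) * (+ 2) ^ n *_) (⟦⟧-cong ((2 ∣? d zero) ×-dec rest?) (all? λ v → 2 ∣? d v)
         (λ { (p , f) zero → p ; (p , f) (suc v) → f v }) (λ f → f zero , f ∘ suc)) ⟩
  (+ 2) * (+ 2) ^ n * ⟦ all? (λ v → 2 ∣? d v) ⟧ ∎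
  where
  f : Subset n → ℤ
  f U = ∏ (λ v → σ (lookup U v) ^ d (suc v)) ⊤
  rest? = all? (λ v → 2 ∣? d (suc v))

prodList : (X → ℤ) → List X → ℤ
prodList φ xs = List.foldr _*_ 1ℤ (List.map φ xs)

prodList-edges : ∀ (φ : Fin m → ℤ) X → prodList φ (filter (_∈? X) (allFin m)) ≡ ∏ φ X
prodList-edges φ []      = refl
prodList-edges {suc m} φ (x ∷ X) = first x
  where
  lower : ∀ x (L : List (Fin m)) → prodList φ (filter (_∈? (x ∷ X)) (List.map suc L)) ≡
                                   prodList (φ ∘ suc) (filter (_∈? X) L)
  lower x []      = refl
  lower x (e ∷ L) with e ∈? X | suc e ∈? (x ∷ X)
  ... | yes _   | yes _   = cong (φ (suc e) *_) (lower x L)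
  ... | yes e∈X | no e∉X  = contradiction (there e∈X) e∉X
  ... | no e∉X  | yes e∈X = contradiction (drop-there e∈X) e∉X
  ... | no _    | no _    = lower x L

  rest : ∀ x → prodList φ (filter (_∈? (x ∷ X)) (List.tabulate suc)) ≡ ∏ (φ ∘ suc) X
  rest x = trans (cong (prodList φ ∘ filter (_∈? (x ∷ X))) (sym (map-tabulate id suc)))
                 (trans (lower x (allFin m)) (prodList-edges (φ ∘ suc) X))

  first : ∀ x → prodList φ (filter (_∈? (x ∷ X)) (allFin (suc m))) ≡ ∏ φ (x ∷ X)
  first outside = rest outside
  first inside  = cong (φ zero *_) (rest inside)

when : Dec P → ℤ → ℤ
when (yes _) x = x
when (no _)  _ = 1ℤ

when-cong : (p? : Dec P) (q? : Dec Q) → (P → Q) → (Q → P) → ∀ x → when p? x ≡ when q? x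
when-cong (yes p) (yes q) _ _ x = refl
when-cong (yes p) (no ¬q) f _ x = contradiction (f p) ¬q
when-cong (no ¬p) (yes q) _ g x = contradiction (g q) ¬p
when-cong (no ¬p) (no ¬q) _ _ x = refl

∏-when-≟ : (h : Fin n → ℤ) (u : Fin n) → ∏ (λ v → when (u Fin.≟ v) (h v)) ⊤ ≡ h u
∏-when-≟ {suc n} h zero    = trans (cong (h zero *_) (∏-1 {n} ⊤)) (*-identityʳ (h zero))
∏-when-≟ {suc n} h (suc u) = trans (*-identityˡ _) (trans
  (∏-cong (λ v → when-cong (suc u Fin.≟ suc v) (u Fin.≟ v) Fin.suc-injective (cong suc) (h (suc v))) (⊤ {n}))
  (∏-when-≟ (h ∘ suc) u))

-- Groups the factors `h (g e)` by the value of `g`. When `g` picks the first or the second end of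
-- an edge, the exponent is one of the two summands of a degree.
∏-^-fibres : (h : Fin n → ℤ) (g : X → Fin n) (L : List X) →
             ∏ (λ v → h v ^ length (filter (λ e → g e Fin.≟ v) L)) ⊤ ≡ prodList (h ∘ g) L
∏-^-fibres {n} h g []      = ∏-1 {n} ⊤
∏-^-fibres {n} h g (e ∷ L) = begin
  ∏ (λ v → h v ^ length (filter (λ e → g e Fin.≟ v) (e ∷ L))) ⊤
    ≡⟨ ∏-cong step (⊤ {n}) ⟩
  ∏ (λ v → when (g e Fin.≟ v) (h v) * h v ^ length (filter (λ e → g e Fin.≟ v) L)) ⊤
    ≡⟨ ∏-* (λ v → when (g e Fin.≟ v) (h v)) _ (⊤ {n}) ⟩
  ∏ (λ v → when (g e Fin.≟ v) (h v)) ⊤ * ∏ (λ v → h v ^ length (filter (λ e → g e Fin.≟ v) L)) ⊤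
    ≡⟨ cong₂ _*_ (∏-when-≟ h (g e)) (∏-^-fibres h g L) ⟩
  h (g e) * prodList (h ∘ g) L ∎
  where
  step : ∀ v → h v ^ length (filter (λ e → g e Fin.≟ v) (e ∷ L)) ≡
               when (g e Fin.≟ v) (h v) * h v ^ length (filter (λ e → g e Fin.≟ v) L)
  step v with g e Fin.≟ v
  ... | yes _ = refl
  ... | no _  = sym (*-identityˡ _)

-- Unions of components are the solutions of a system in which the least vertex of each component is
-- `free` and every other vertex copies a smaller one. `const` appears only during elimination, when
-- the copied vertex has already been decided.
data Constraint (n : ℕ) : Set where
  free  : Constraint n
  const : Side → Constraint n
  copy  : Fin n → Constraint n

data Free {n : ℕ} : Constraint n → Set where
  free : Free free

free? : Decidable (Free {n})
free? free      = yes free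
free? (const _) = no λ ()
free? (copy _)  = no λ ()

Holds : Constraint n → Side → Subset n → Set
Holds free      b U = Unit.⊤
Holds (const c) b U = b ≡ c
Holds (copy u)  b U = b ≡ lookup U u

holds? : ∀ (x : Constraint n) b U → Dec (Holds x b U)
holds? free      b U = yes Unit.tt
holds? (const c) b U = b Bool.≟ c
holds? (copy u)  b U = b Bool.≟ lookup U u

Satisfies : (Fin n → Constraint n) → Subset n → Set
Satisfies c U = ∀ v → Holds (c v) (lookup U v) U

satisfies? : ∀ (c : Fin n → Constraint n) U → Dec (Satisfies c U)
satisfies? c U = all? λ v → holds? (c v) (lookup U v) U

substitute : Side → Constraint (suc n) → Constraint n
substitute b free           = free
substitute b (const c)      = const c
substitute b (copy zero)    = const b
substitute b (copy (suc u)) = copy u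

substitute-⇒ : ∀ b (x : Constraint (suc n)) {d U} → Holds x d (b ∷ U) → Holds (substitute b x) d U
substitute-⇒ b free           h = h
substitute-⇒ b (const c)      h = h
substitute-⇒ b (copy zero)    h = h
substitute-⇒ b (copy (suc u)) h = h

substitute-⇐ : ∀ b (x : Constraint (suc n)) {d U} → Holds (substitute b x) d U → Holds x d (b ∷ U)
substitute-⇐ b free           h = h
substitute-⇐ b (const c)      h = h
substitute-⇐ b (copy zero)    h = h
substitute-⇐ b (copy (suc u)) h = h

substitute-free-⇒ : ∀ b (x : Constraint (suc n)) → Free x → Free (substitute b x)
substitute-free-⇒ b free free = free

substitute-free-⇐ : ∀ b (x : Constraint (suc n)) → Free (substitute b x) → Free x
substitute-free-⇐ b free        free = free
substitute-free-⇐ b (copy zero) ()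

-- Guarantees that vertex 0 is never a copy, so that it can always be eliminated; elimination
-- preserves the property.
Triangular : (Fin n → Constraint n) → Set
Triangular c = ∀ v {u} → c v ≡ copy u → u Fin.< v

substitute-triangular : ∀ b (c : Fin (suc n) → Constraint (suc n)) →
                        Triangular c → Triangular (substitute b ∘ c ∘ suc)
substitute-triangular b c tri v eq with c (suc v) in eq′
substitute-triangular b c tri v refl | copy (suc u) = ℕ.s<s⁻¹ (tri (suc v) eq′)

length-filter-suc : {P : Pred (Fin (suc n)) 0ℓ} (P? : Decidable P) →
  length (filter P? (List.tabulate suc)) ≡ length (filter (P? ∘ suc) (allFin n))
length-filter-suc {n} P? = trans (cong (length ∘ filter P?) (sym (map-tabulate id suc))) (go (allFin n))
  where
  go : ∀ L → length (filter P? (List.map suc L)) ≡ length (filter (P? ∘ suc) L)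
  go []      = refl
  go (e ∷ L) with P? (suc e)
  ... | yes _ = cong suc (go L)
  ... | no _  = go L

-- Deciding vertex 0 turns copies of it into constants and leaves the other free vertices free.
∑-satisfies : (c : Fin n → Constraint n) → Triangular c →
  ∑ (λ U → ⟦ satisfies? c U ⟧) ≡ (+ 2) ^ length (filter (λ v → free? (c v)) (allFin n))
∑-satisfies {zero}  c tri = trans (∑-[] _) (⟦⟧-true (satisfies? c []) λ ())
∑-satisfies {suc n} c tri = first (c zero) refl
  where
  c′ : Side → Fin n → Constraint n
  c′ b = substitute b ∘ c ∘ suc

  F : ℕ
  F = length (filter (λ v → free? (c v)) (List.tabulate suc))

  rest : ∀ b → ∑ (λ U → ⟦ satisfies? (c′ b) U ⟧) ≡ (+ 2) ^ F
  rest b = trans (∑-satisfies (c′ b) (substitute-triangular b c tri)) (cong ((+ 2) ^_) (begin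
    length (filter (λ v → free? (c′ b v)) (allFin n))
      ≡⟨ cong length (filter-≐ (λ v → free? (c′ b v)) (λ v → free? (c (suc v)))
           ((λ {v} → substitute-free-⇐ b (c (suc v))) , (λ {v} → substitute-free-⇒ b (c (suc v))))
           (allFin n)) ⟩
    length (filter (λ v → free? (c (suc v))) (allFin n))
      ≡⟨ length-filter-suc (λ v → free? (c v)) ⟨
    F ∎))

  split : ∀ b U → Holds (c zero) b (b ∷ U) → ⟦ satisfies? c (b ∷ U) ⟧ ≡ ⟦ satisfies? (c′ b) U ⟧
  split b U h = ⟦⟧-cong (satisfies? c (b ∷ U)) (satisfies? (c′ b) U)
    (λ f v → substitute-⇒ b (c (suc v)) (f (suc v)))
    (λ { f zero → h ; f (suc v) → substitute-⇐ b (c (suc v)) (f v) })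

  half : ∀ b → (∀ U → Holds (c zero) b (b ∷ U)) → ∑ (λ U → ⟦ satisfies? c (b ∷ U) ⟧) ≡ (+ 2) ^ F
  half b h = trans (∑-cong λ U → split b U (h U)) (rest b)

  none : ∀ b → (∀ U → ¬ Holds (c zero) b (b ∷ U)) → ∑ (λ U → ⟦ satisfies? c (b ∷ U) ⟧) ≡ 0ℤ
  none b ¬h = trans (∑-cong λ U → ⟦⟧-false (satisfies? c (b ∷ U)) λ f → ¬h U (f zero)) (∑-0 {n})

  first : ∀ x → c zero ≡ x →
    ∑ (λ U → ⟦ satisfies? c U ⟧) ≡ (+ 2) ^ length (filter (λ v → free? (c v)) (allFin (suc n)))
  first free eq = trans (trans
    (∑-∷-≡ (half outside λ U → subst (λ x → Holds x outside (outside ∷ U)) (sym eq) Unit.tt)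
           (half inside λ U → subst (λ x → Holds x inside (inside ∷ U)) (sym eq) Unit.tt))
    (lem ((+ 2) ^ F)))
    (cong (λ L → (+ 2) ^ length L) (sym (filter-accept (λ v → free? (c v)) (subst Free (sym eq) free))))
    where
    lem : ∀ x → x + x ≡ (+ 2) * x
    lem = solve-∀
  first (const outside) eq = trans (trans
    (∑-∷-≡ (half outside λ U → subst (λ x → Holds x outside (outside ∷ U)) (sym eq) refl)
           (none inside λ U h → case (subst (λ x → Holds x inside (inside ∷ U)) eq h)))
    (+-identityʳ _))
    (cong (λ L → (+ 2) ^ length L) (sym (filter-reject (λ v → free? (c v)) λ f → notFree (subst Free eq f))))
    where
    notFree : ∀ {d} → ¬ Free {suc n} (const d)
    notFree ()
    case : ¬ inside ≡ outside
    case ()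
  first (const inside) eq = trans (trans
    (∑-∷-≡ (none outside λ U h → case (subst (λ x → Holds x outside (outside ∷ U)) eq h))
           (half inside λ U → subst (λ x → Holds x inside (inside ∷ U)) (sym eq) refl))
    (+-identityˡ _))
    (cong (λ L → (+ 2) ^ length L) (sym (filter-reject (λ v → free? (c v)) λ f → notFree (subst Free eq f))))
    where
    notFree : ∀ {d} → ¬ Free {suc n} (const d)
    notFree ()
    case : ¬ outside ≡ inside
    case ()
  -- A copy at vertex 0 would refer to a vertex below 0.
  first (copy u) eq = contradiction (tri zero eq) λ ()

-- Counting eulerian subgraphs

module _ (G : Graph) where
  open Graph G

  private
    s t : Fin #E → Fin #V
    s e = proj₁ (ends e)
    t e = proj₂ (ends e)

  edgeSign : Subset #V → Fin #E → ℤ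
  edgeSign U e = σ (lookup U (s e)) * σ (lookup U (t e))

  -- A product of one sign per incidence of a vertex with an edge of X, collected by vertices on the
  -- left and by edges on the right. A loop occurs in both lists of ends and contributes the square
  -- of a sign.
  ∏-degree : ∀ U X → ∏ (λ v → σ (lookup U v) ^ degree G X v) ⊤ ≡ ∏ (edgeSign U) X
  ∏-degree U X = begin
    ∏ (λ v → h v ^ degree G X v) ⊤
      ≡⟨ ∏-cong (λ v → ^-distribˡ-+-* (h v) (at s v) (at t v)) (⊤ {#V}) ⟩
    ∏ (λ v → h v ^ at s v * h v ^ at t v) ⊤
      ≡⟨ ∏-* (λ v → h v ^ at s v) (λ v → h v ^ at t v) (⊤ {#V}) ⟩
    ∏ (λ v → h v ^ at s v) ⊤ * ∏ (λ v → h v ^ at t v) ⊤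
      ≡⟨ cong₂ _*_ (∏-^-fibres h s (edges G X)) (∏-^-fibres h t (edges G X)) ⟩
    prodList (h ∘ s) (edges G X) * prodList (h ∘ t) (edges G X)
      ≡⟨ cong₂ _*_ (prodList-edges (h ∘ s) X) (prodList-edges (h ∘ t) X) ⟩
    ∏ (h ∘ s) X * ∏ (h ∘ t) X
      ≡⟨ ∏-* (h ∘ s) (h ∘ t) X ⟨
    ∏ (edgeSign U) X ∎
    where
    h : Fin #V → ℤ
    h v = σ (lookup U v)
    at : (Fin #E → Fin #V) → Fin #V → ℕ
    at g v = length (filter (λ e → g e Fin.≟ v) (edges G X))

  ∑-edgeSign : ∀ X → ∑ (λ U → ∏ (edgeSign U) X) ≡ (+ 2) ^ #V * ⟦ eulerian? G X ⟧
  ∑-edgeSign X = trans (∑-cong λ U → sym (∏-degree U X)) (∑-∏-σ (degree G X))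

  evenSubgraphs : Subset #E → ℤ
  evenSubgraphs A = ∑ λ X → ⟦ X ⊆ A ⟧ * ⟦ eulerian? G X ⟧

  balanced? : ∀ U e → Dec (lookup U (s e) ≡ lookup U (t e))
  balanced? U e = lookup U (s e) Bool.≟ lookup U (t e)

  1+edgeSign : ∀ U e → 1ℤ + edgeSign U e ≡ (+ 2) * ⟦ balanced? U e ⟧
  1+edgeSign U e with lookup U (s e) | lookup U (t e)
  ... | outside | outside = refl
  ... | outside | inside  = refl
  ... | inside  | outside = refl
  ... | inside  | inside  = refl

  smallerNeighbour? : ∀ A v → Dec (∃ λ u → u Fin.< v × Connected ends A u v)
  smallerNeighbour? A v = any? λ u → (u Fin.<? v) ×-dec connected? ends A u v

  constraint : ∀ {A v} → Dec (∃ λ u → u Fin.< v × Connected ends A u v) → Constraint #V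
  constraint (yes (u , _)) = copy u
  constraint (no _)        = free

  -- The free vertices are exactly those that `k` counts. The copied vertex is whichever smaller
  -- vertex of the component the search returns.
  leastConstraint : Subset #E → Fin #V → Constraint #V
  leastConstraint A v = constraint (smallerNeighbour? A v)

  leastConstraint-triangular : ∀ A → Triangular (leastConstraint A)
  leastConstraint-triangular A v eq with smallerNeighbour? A v
  leastConstraint-triangular A v refl | yes (u , u<v , _) = u<v

  length-free : ∀ A → length (filter (λ v → free? (leastConstraint A v)) (allFin #V)) ≡ k G A
  length-free A = cong length (filter-≐ (λ v → free? (leastConstraint A v))
    (λ v → ¬? (smallerNeighbour? A v))
    ((λ {v} → to (smallerNeighbour? A v)) , (λ {v} → from (smallerNeighbour? A v))) (allFin #V))
    where
    to : ∀ {v} (d : Dec (∃ λ u → u Fin.< v × Connected ends A u v)) → Free (constraint d) →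
         ¬ ∃ λ u → u Fin.< v × Connected ends A u v
    to (no ¬p) _ = ¬p
    from : ∀ {v} (d : Dec (∃ λ u → u Fin.< v × Connected ends A u v)) →
           ¬ (∃ λ u → u Fin.< v × Connected ends A u v) → Free (constraint d)
    from (yes p) ¬p = contradiction p ¬p
    from (no _)  _  = free

  -- Having the same membership in U is an equivalence relation that contains the edges of A, hence
  -- it contains connectivity.
  balanced⇒satisfies : ∀ A U → (∀ e → e ∈ A → lookup U (s e) ≡ lookup U (t e)) →
                       Satisfies (leastConstraint A) U
  balanced⇒satisfies A U bal v with smallerNeighbour? A v
  ... | no _              = Unit.tt
  ... | yes (u , _ , u~v) = sym (Eq.fold
    (record { refl = refl ; sym = sym ; trans = trans })
    (λ { (e , e∈A , refl) → bal e e∈A }) u~v)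

  -- N is a bound for induction on u + v: the larger of the two is replaced by a smaller neighbour.
  satisfies⇒constant : ∀ A U → Satisfies (leastConstraint A) U → ∀ N {u v} →
    toℕ u ℕ.+ toℕ v ℕ.< N → Connected ends A u v → lookup U u ≡ lookup U v
  satisfies⇒constant A U sat (suc N) {u} {v} u+v<N u~v with Fin.<-cmp u v
  ... | tri≈ _ refl _ = refl
  ... | tri< u<v _ _ with smallerNeighbour? A v | sat v
  ...   | no ¬p               | _  = contradiction (u , u<v , u~v) ¬p
  ...   | yes (w , w<v , w~v) | eq = trans
    (satisfies⇒constant A U sat N
      (ℕ.<-≤-trans (ℕ.+-monoʳ-< (toℕ u) w<v) (ℕ.s≤s⁻¹ u+v<N))
      (Eq.transitive _ u~v (Eq.symmetric _ w~v)))
    (sym eq)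
  satisfies⇒constant A U sat (suc N) {u} {v} u+v<N u~v | tri> _ _ v<u
    with smallerNeighbour? A u | sat u
  ...   | no ¬p               | _  = contradiction (v , v<u , Eq.symmetric _ u~v) ¬p
  ...   | yes (w , w<u , w~u) | eq = trans eq
    (satisfies⇒constant A U sat N
      (ℕ.<-≤-trans (ℕ.+-monoˡ-< (toℕ v) w<u) (ℕ.s≤s⁻¹ u+v<N))
      (Eq.transitive _ w~u u~v))

  ∑-balanced : ∀ A → ∑ (λ U → ⟦ everywhere? (balanced? U) A ⟧) ≡ (+ 2) ^ k G A
  ∑-balanced A = begin
    ∑ (λ U → ⟦ everywhere? (balanced? U) A ⟧)
      ≡⟨ ∑-cong (λ U → ⟦⟧-cong (everywhere? (balanced? U) A) (satisfies? (leastConstraint A) U)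
           (balanced⇒satisfies A U)
           (λ sat e e∈A → satisfies⇒constant A U sat _ (ℕ.n<1+n _) (Eq.return (e , e∈A , refl)))) ⟩
    ∑ (λ U → ⟦ satisfies? (leastConstraint A) U ⟧)
      ≡⟨ ∑-satisfies (leastConstraint A) (leastConstraint-triangular A) ⟩
    (+ 2) ^ length (filter (λ v → free? (leastConstraint A v)) (allFin #V))
      ≡⟨ cong ((+ 2) ^_) (length-free A) ⟩
    (+ 2) ^ k G A ∎

  -- Double counting of the sum, over X ⊆ A and U ⊆ V, of (-1) to the number of edges of X that
  -- leave U: summing over U first keeps the eulerian X, summing over X first keeps the U that are
  -- unions of components of (V , A).
  evenSubgraphs-k : ∀ A → (+ 2) ^ #V * evenSubgraphs A ≡ (+ 2) ^ ∣ A ∣ * (+ 2) ^ k G A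
  evenSubgraphs-k A = begin
    (+ 2) ^ #V * evenSubgraphs A
      ≡⟨ ∑-*ˡ ((+ 2) ^ #V) _ ⟨
    ∑ (λ X → (+ 2) ^ #V * (⟦ X ⊆ A ⟧ * ⟦ eulerian? G X ⟧))
      ≡⟨ ∑-cong (λ X → trans (swap ((+ 2) ^ #V) ⟦ X ⊆ A ⟧ ⟦ eulerian? G X ⟧)
           (trans (cong (⟦ X ⊆ A ⟧ *_) (sym (∑-edgeSign X)))
                  (sym (∑-*ˡ ⟦ X ⊆ A ⟧ (λ U → ∏ (edgeSign U) X))))) ⟩
    ∑ (λ X → ∑ λ U → ⟦ X ⊆ A ⟧ * ∏ (edgeSign U) X)
      ≡⟨ ∑-swap (λ X U → ⟦ X ⊆ A ⟧ * ∏ (edgeSign U) X) ⟩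
    ∑ (λ U → ∑ λ X → ⟦ X ⊆ A ⟧ * ∏ (edgeSign U) X)
      ≡⟨ ∑-cong (λ U → trans (∑-⊆-∏ (edgeSign U) A)
           (trans (∏-cong (1+edgeSign U) A) (∏-⟦⟧ (balanced? U) A))) ⟩
    ∑ (λ U → (+ 2) ^ ∣ A ∣ * ⟦ everywhere? (balanced? U) A ⟧)
      ≡⟨ ∑-*ˡ ((+ 2) ^ ∣ A ∣) (λ U → ⟦ everywhere? (balanced? U) A ⟧) ⟩
    (+ 2) ^ ∣ A ∣ * ∑ (λ U → ⟦ everywhere? (balanced? U) A ⟧)
      ≡⟨ cong ((+ 2) ^ ∣ A ∣ *_) (∑-balanced A) ⟩
    (+ 2) ^ ∣ A ∣ * (+ 2) ^ k G A ∎
    where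
    swap : ∀ a b c → a * (b * c) ≡ b * (a * c)
    swap = solve-∀

-- The Tutte polynomial at (-1,-1)

^-nonZero : ∀ n → (+ 2) ^ n ≢ 0ℤ
^-nonZero n eq with i^n≡0⇒i≡0 (+ 2) n eq
... | ()

2^-cancelʳ : ∀ n {i j} → i * (+ 2) ^ n ≡ j * (+ 2) ^ n → i ≡ j
2^-cancelʳ n {i} {j} = *-cancelʳ-≡ i j ((+ 2) ^ n) {{≢-nonZero (^-nonZero n)}}

-- If a > b, cancelling 2 ^ b would make 1 an even number. Thus the integrality of `c` alone yields
-- the inequality of exponents, and with it the exact value of `c`.
2^-factor : ∀ a b {c} → (+ 2) ^ a * c ≡ (+ 2) ^ b → a ℕ.≤ b × c ≡ (+ 2) ^ (b ℕ.∸ a)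
2^-factor a b {c} eq with a ℕ.≤? b
... | yes a≤b = a≤b , 2^-cancelʳ a (begin
  c * (+ 2) ^ a                  ≡⟨ *-comm c _ ⟩
  (+ 2) ^ a * c                  ≡⟨ eq ⟩
  (+ 2) ^ b                      ≡⟨ cong ((+ 2) ^_) (ℕ.m∸n+n≡m a≤b) ⟨
  (+ 2) ^ (b ℕ.∸ a ℕ.+ a)        ≡⟨ ^-distribˡ-+-* (+ 2) (b ℕ.∸ a) a ⟩
  (+ 2) ^ (b ℕ.∸ a) * (+ 2) ^ a  ∎)
... | no a≰b = contradiction
  (ℕ.m*n≡1⇒m≡1 2 ℤ.∣ (+ 2) ^ e * c ∣ (trans (sym (abs-* (+ 2) ((+ 2) ^ e * c))) (cong ℤ.∣_∣ odd))) λ ()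
  where
  e = a ℕ.∸ suc b
  lem : ∀ x y c → (+ 2) * (x * c) * y ≡ (x * ((+ 2) * y)) * c
  lem = solve-∀
  odd : (+ 2) * ((+ 2) ^ e * c) ≡ 1ℤ
  odd = 2^-cancelʳ b (begin
    (+ 2) * ((+ 2) ^ e * c) * (+ 2) ^ b   ≡⟨ lem ((+ 2) ^ e) ((+ 2) ^ b) c ⟩
    (+ 2) ^ e * (+ 2) ^ suc b * c         ≡⟨ cong (_* c) (^-distribˡ-+-* (+ 2) e (suc b)) ⟨
    (+ 2) ^ (e ℕ.+ suc b) * c             ≡⟨ cong (λ z → (+ 2) ^ z * c) (ℕ.m∸n+n≡m (ℕ.≰⇒> a≰b)) ⟩
    (+ 2) ^ a * c                         ≡⟨ eq ⟩
    (+ 2) ^ b                             ≡⟨ *-identityˡ _ ⟨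
    1ℤ * (+ 2) ^ b                        ∎)

length-filter-mono : {P Q : Pred X 0ℓ} (P? : Decidable P) (Q? : Decidable Q) →
  (∀ x → P x → Q x) → ∀ xs → length (filter P? xs) ℕ.≤ length (filter Q? xs)
length-filter-mono P? Q? P⇒Q []       = ℕ.z≤n
length-filter-mono P? Q? P⇒Q (x ∷ xs) with P? x | Q? x
... | yes _ | yes _ = ℕ.s≤s (length-filter-mono P? Q? P⇒Q xs)
... | yes p | no ¬q = contradiction (P⇒Q x p) ¬q
... | no _  | yes _ = ℕ.m≤n⇒m≤1+n (length-filter-mono P? Q? P⇒Q xs)
... | no _  | no _  = length-filter-mono P? Q? P⇒Q xs

-2^ : ∀ n → -[1+ 1 ] ^ n ≡ -1ℤ ^ n * (+ 2) ^ n
-2^ zero    = refl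
-2^ (suc n) = trans (cong (-[1+ 1 ] *_) (-2^ n)) (*-interchange -1ℤ (+ 2) (-1ℤ ^ n) ((+ 2) ^ n))

-1^-square : ∀ n → -1ℤ ^ n * -1ℤ ^ n ≡ 1ℤ
-1^-square zero    = refl
-1^-square (suc n) = trans (*-interchange -1ℤ (-1ℤ ^ n) -1ℤ (-1ℤ ^ n)) (cong (1ℤ *_) (-1^-square n))

∣∁∣+∣∣ : (A : Subset m) → ∣ ∁ A ∣ ℕ.+ ∣ A ∣ ≡ m
∣∁∣+∣∣ []            = refl
∣∁∣+∣∣ (outside ∷ A) = cong suc (∣∁∣+∣∣ A)
∣∁∣+∣∣ (inside ∷ A)  = trans (ℕ.+-suc ∣ ∁ A ∣ ∣ A ∣) (cong suc (∣∁∣+∣∣ A))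

weight : Subset m → ℤ
weight A = sgn A * (+ 2) ^ ∣ ∁ A ∣

-- The sum factorises over the edges: an edge outside Y may be left out or taken, 2 - 1 = 1, while
-- an edge of Y has to be taken and gives -1.
∑-⊆-weight : (Y : Subset m) → ∑ (λ A → ⟦ Y ⊆ A ⟧ * weight A) ≡ sgn Y
∑-⊆-weight []            = ∑-[] _
∑-⊆-weight (outside ∷ Y) = trans (∑-∷-≡
  (trans (∑-cong λ A → lem₁ ⟦ Y ⊆ A ⟧ (sgn A) ((+ 2) ^ ∣ ∁ A ∣))
    (trans (∑-*ˡ (+ 2) _) (cong ((+ 2) *_) (∑-⊆-weight Y))))
  (trans (∑-cong λ A → lem₂ ⟦ Y ⊆ A ⟧ (sgn A) ((+ 2) ^ ∣ ∁ A ∣))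
    (trans (∑-*ˡ -1ℤ _) (cong (-1ℤ *_) (∑-⊆-weight Y)))))
  (lem₃ (sgn Y))
  where
  lem₁ : ∀ x s w → x * (s * ((+ 2) * w)) ≡ (+ 2) * (x * (s * w))
  lem₁ = solve-∀
  lem₂ : ∀ x s w → x * (-1ℤ * s * w) ≡ -1ℤ * (x * (s * w))
  lem₂ = solve-∀
  lem₃ : ∀ s → (+ 2) * s + -1ℤ * s ≡ s
  lem₃ = solve-∀
∑-⊆-weight {suc m} (inside ∷ Y)  = trans (∑-∷-≡
  (trans (∑-cong λ A → *-zeroˡ (sgn A * ((+ 2) * (+ 2) ^ ∣ ∁ A ∣))) (∑-0 {m}))
  (trans (∑-cong λ A → lem ⟦ Y ⊆ A ⟧ (sgn A) ((+ 2) ^ ∣ ∁ A ∣))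
    (trans (∑-*ˡ -1ℤ _) (cong (-1ℤ *_) (∑-⊆-weight Y)))))
  (+-identityˡ _)
  where
  lem : ∀ x s w → x * (-1ℤ * s * w) ≡ -1ℤ * (x * (s * w))
  lem = solve-∀

⟦⊆⟧-∪ : (X Y A : Subset m) → ⟦ X ⊆ A ⟧ * ⟦ Y ⊆ A ⟧ ≡ ⟦ X ∪ Y ⊆ A ⟧
⟦⊆⟧-∪ []            []            []            = refl
⟦⊆⟧-∪ (outside ∷ X) (outside ∷ Y) (_ ∷ A)       = ⟦⊆⟧-∪ X Y A
⟦⊆⟧-∪ (outside ∷ X) (inside ∷ Y)  (outside ∷ A) = *-zeroʳ ⟦ X ⊆ A ⟧
⟦⊆⟧-∪ (outside ∷ X) (inside ∷ Y)  (inside ∷ A)  = ⟦⊆⟧-∪ X Y A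
⟦⊆⟧-∪ (inside ∷ X)  (y ∷ Y)       (outside ∷ A) = *-zeroˡ ⟦ y ∷ Y ⊆ outside ∷ A ⟧
⟦⊆⟧-∪ (inside ∷ X)  (outside ∷ Y) (inside ∷ A)  = ⟦⊆⟧-∪ X Y A
⟦⊆⟧-∪ (inside ∷ X)  (inside ∷ Y)  (inside ∷ A)  = ⟦⊆⟧-∪ X Y A

⟦⊆⊤⟧ : (X : Subset m) → ⟦ X ⊆ ⊤ ⟧ ≡ 1ℤ
⟦⊆⊤⟧ []            = refl
⟦⊆⊤⟧ (outside ∷ X) = ⟦⊆⊤⟧ X
⟦⊆⊤⟧ (inside ∷ X)  = ⟦⊆⊤⟧ X

module _ (G : Graph) where
  open Graph G

  private
    χ : Subset #E → ℤ
    χ X = ⟦ eulerian? G X ⟧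

  k≤#V : ∀ A → k G A ℕ.≤ #V
  k≤#V A = ℕ.≤-trans (length-filter (λ v → ¬? (smallerNeighbour? G A v)) (allFin #V))
                     (ℕ.≤-reflexive (length-tabulate {n = #V} id))

  -- Paths in A remain paths when all edges are present, so a vertex that is least in its component
  -- of the whole graph is least in its component of (V , A).
  r-mono : ∀ A → r G A ℕ.≤ r G ⊤
  r-mono A = ℕ.∸-monoʳ-≤ #V (length-filter-mono
    (λ v → ¬? (smallerNeighbour? G ⊤ v)) (λ v → ¬? (smallerNeighbour? G A v))
    (λ v ¬p → λ (u , u<v , u~v) → ¬p (u , u<v , Eq.map (λ (i , _ , eq) → i , ∈⊤ , eq) u~v))
    (allFin #V))

  -- The double count with 2 ^ k A cancelled, since #V = r A + k A. It is kept in multiplied form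
  -- because r A ≤ |A| is about to be deduced from it.
  evenSubgraphs-r : ∀ A → (+ 2) ^ r G A * evenSubgraphs G A ≡ (+ 2) ^ ∣ A ∣
  evenSubgraphs-r A = 2^-cancelʳ (k G A) (begin
    (+ 2) ^ r G A * evenSubgraphs G A * (+ 2) ^ k G A
      ≡⟨ lem ((+ 2) ^ r G A) (evenSubgraphs G A) ((+ 2) ^ k G A) ⟩
    (+ 2) ^ r G A * (+ 2) ^ k G A * evenSubgraphs G A
      ≡⟨ cong (_* evenSubgraphs G A) (^-distribˡ-+-* (+ 2) (r G A) (k G A)) ⟨
    (+ 2) ^ (r G A ℕ.+ k G A) * evenSubgraphs G A
      ≡⟨ cong (λ z → (+ 2) ^ z * evenSubgraphs G A) (ℕ.m∸n+n≡m (k≤#V A)) ⟩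
    (+ 2) ^ #V * evenSubgraphs G A
      ≡⟨ evenSubgraphs-k G A ⟩
    (+ 2) ^ ∣ A ∣ * (+ 2) ^ k G A ∎)
    where
    lem : ∀ a b c → a * b * c ≡ a * c * b
    lem = solve-∀

  r≤∣∣ : ∀ A → r G A ℕ.≤ ∣ A ∣
  r≤∣∣ A = proj₁ (2^-factor (r G A) ∣ A ∣ (evenSubgraphs-r A))

  evenSubgraphs-2^ : ∀ A → evenSubgraphs G A ≡ (+ 2) ^ (∣ A ∣ ℕ.∸ r G A)
  evenSubgraphs-2^ A = proj₂ (2^-factor (r G A) ∣ A ∣ (evenSubgraphs-r A))

  nullity+rank : nullity G ℕ.+ rank G ≡ #E
  nullity+rank = ℕ.m∸n+n≡m (subst (rank G ℕ.≤_) (∣⊤∣≡n #E) (r≤∣∣ ⊤))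

  ∑-eulerian : ∑ χ ≡ (+ 2) ^ nullity G
  ∑-eulerian = begin
    ∑ χ                           ≡⟨ ∑-cong (λ X → trans (cong (_* χ X) (⟦⊆⊤⟧ X)) (*-identityˡ (χ X))) ⟨
    evenSubgraphs G ⊤             ≡⟨ evenSubgraphs-2^ ⊤ ⟩
    (+ 2) ^ (∣ ⊤ {#E} ∣ ℕ.∸ rank G)  ≡⟨ cong (λ z → (+ 2) ^ (z ℕ.∸ rank G)) (∣⊤∣≡n #E) ⟩
    (+ 2) ^ nullity G             ∎

  eulerianPairs : ℤ
  eulerianPairs = ∑ λ X → ∑ λ Y → χ X * χ Y * sgn (X ∪ Y)

  ∑-weight-evenSubgraphs : ∑ (λ A → weight A * (evenSubgraphs G A * evenSubgraphs G A)) ≡ eulerianPairs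
  ∑-weight-evenSubgraphs = begin
    ∑ (λ A → weight A * (evenSubgraphs G A * evenSubgraphs G A))
      ≡⟨ ∑-cong (λ A → trans (cong (weight A *_) (sym (∑-product (f A) (f A))))
           (trans (sym (∑-*ˡ (weight A) _)) (∑-cong λ X → trans (sym (∑-*ˡ (weight A) _)) (∑-cong λ Y →
             trans (lem (weight A) ⟦ X ⊆ A ⟧ ⟦ Y ⊆ A ⟧ (χ X) (χ Y))
                   (cong (λ z → χ X * χ Y * (z * weight A)) (⟦⊆⟧-∪ X Y A)))))) ⟩
    ∑ (λ A → ∑ λ X → ∑ λ Y → χ X * χ Y * (⟦ X ∪ Y ⊆ A ⟧ * weight A))
      ≡⟨ ∑-swap _ ⟩
    ∑ (λ X → ∑ λ A → ∑ λ Y → χ X * χ Y * (⟦ X ∪ Y ⊆ A ⟧ * weight A))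
      ≡⟨ ∑-cong (λ X → ∑-swap _) ⟩
    ∑ (λ X → ∑ λ Y → ∑ λ A → χ X * χ Y * (⟦ X ∪ Y ⊆ A ⟧ * weight A))
      ≡⟨ ∑-cong (λ X → ∑-cong λ Y → trans (∑-*ˡ (χ X * χ Y) _)
           (cong (χ X * χ Y *_) (∑-⊆-weight (X ∪ Y)))) ⟩
    eulerianPairs ∎
    where
    f : Subset #E → Subset #E → ℤ
    f A X = ⟦ X ⊆ A ⟧ * χ X
    lem : ∀ w x y a b → w * ((x * a) * (y * b)) ≡ a * b * ((x * y) * w)
    lem = solve-∀

  -- Signs: (-1) ^ rank cancels the sign of the first power and leaves (-1) ^ r A, which together
  -- with (-1) ^ (|A| - r A) makes (-1) ^ |A|. Powers of 2: multiplying by 2 ^ nullity turns 2 ^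
  -- (rank - r A) into 2 ^ |E - A| times a second copy of 2 ^ (|A| - r A), which completes the
  -- square.
  Tutte-term : ∀ A → -1ℤ ^ rank G * (+ 2) ^ nullity G *
                     (-[1+ 1 ] ^ (r G ⊤ ℕ.∸ r G A) * -[1+ 1 ] ^ (∣ A ∣ ℕ.∸ r G A))
                   ≡ weight A * (evenSubgraphs G A * evenSubgraphs G A)
  Tutte-term A = begin
    -1ℤ ^ rank G * N * (-[1+ 1 ] ^ x * -[1+ 1 ] ^ d)
      ≡⟨ cong₂ (λ y z → y * N * z) (-1-split x q x+q) (cong₂ _*_ (-2^ x) (-2^ d)) ⟩
    (-1ℤ ^ x * -1ℤ ^ q) * N * ((-1ℤ ^ x * (+ 2) ^ x) * (-1ℤ ^ d * (+ 2) ^ d))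
      ≡⟨ lem₁ (-1ℤ ^ x) (-1ℤ ^ q) N ((+ 2) ^ x) (-1ℤ ^ d) ((+ 2) ^ d) ⟩
    (-1ℤ ^ x * -1ℤ ^ x) * ((-1ℤ ^ d * -1ℤ ^ q) * (N * (+ 2) ^ x) * (+ 2) ^ d)
      ≡⟨ cong₂ (λ y z → y * ((-1ℤ ^ d * -1ℤ ^ q) * z * (+ 2) ^ d)) (-1^-square x) exponents ⟩
    1ℤ * ((-1ℤ ^ d * -1ℤ ^ q) * ((+ 2) ^ p * (+ 2) ^ d) * (+ 2) ^ d)
      ≡⟨ lem₂ (-1ℤ ^ d * -1ℤ ^ q) ((+ 2) ^ p) ((+ 2) ^ d) ⟩
    (-1ℤ ^ d * -1ℤ ^ q) * (+ 2) ^ p * ((+ 2) ^ d * (+ 2) ^ d)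
      ≡⟨ cong₂ (λ y z → y * (+ 2) ^ p * (z * z)) (-1-split d q d+q) (evenSubgraphs-2^ A) ⟨
    weight A * (evenSubgraphs G A * evenSubgraphs G A) ∎
    where
    N : ℤ
    N = (+ 2) ^ nullity G
    q x d p : ℕ
    q = r G A
    x = r G ⊤ ℕ.∸ q
    d = ∣ A ∣ ℕ.∸ q
    p = ∣ ∁ A ∣
    x+q : x ℕ.+ q ≡ rank G
    x+q = ℕ.m∸n+n≡m (r-mono A)
    d+q : d ℕ.+ q ≡ ∣ A ∣
    d+q = ℕ.m∸n+n≡m (r≤∣∣ A)
    -1-split : ∀ a b {c} → a ℕ.+ b ≡ c → -1ℤ ^ c ≡ -1ℤ ^ a * -1ℤ ^ b
    -1-split a b refl = ^-distribˡ-+-* -1ℤ a b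
    -- After adding `q`, both sides count all edges: nullity plus rank on the left, complement plus
    -- A on the right.
    sums : nullity G ℕ.+ x ≡ p ℕ.+ d
    sums = ℕ.+-cancelʳ-≡ q _ _ (trans (ℕ.+-assoc (nullity G) x q)
      (trans (cong (nullity G ℕ.+_) x+q) (trans nullity+rank (trans (sym (∣∁∣+∣∣ A))
      (trans (cong (p ℕ.+_) (sym d+q)) (sym (ℕ.+-assoc p d q)))))))
    exponents : N * (+ 2) ^ x ≡ (+ 2) ^ p * (+ 2) ^ d
    exponents = trans (sym (^-distribˡ-+-* (+ 2) (nullity G) x))
      (trans (cong ((+ 2) ^_) sums) (^-distribˡ-+-* (+ 2) p d))
    lem₁ : ∀ X Q N x D d → (X * Q) * N * ((X * x) * (D * d)) ≡ (X * X) * ((D * Q) * (N * x) * d)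
    lem₁ = solve-∀
    lem₂ : ∀ s p d → 1ℤ * (s * (p * d) * d) ≡ s * p * (d * d)
    lem₂ = solve-∀

  eulerianPairs-Tutte : eulerianPairs ≡ -1ℤ ^ rank G * (+ 2) ^ nullity G * Tutte G -1ℤ -1ℤ
  eulerianPairs-Tutte = begin
    eulerianPairs
      ≡⟨ ∑-weight-evenSubgraphs ⟨
    ∑ (λ A → weight A * (evenSubgraphs G A * evenSubgraphs G A))
      ≡⟨ ∑-cong Tutte-term ⟨
    ∑ (λ A → -1ℤ ^ rank G * (+ 2) ^ nullity G * term A)
      ≡⟨ ∑-*ˡ (-1ℤ ^ rank G * (+ 2) ^ nullity G) term ⟩
    -1ℤ ^ rank G * (+ 2) ^ nullity G * ∑ term
      ≡⟨ cong (-1ℤ ^ rank G * (+ 2) ^ nullity G *_) (sumList-subsets term) ⟨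
    -1ℤ ^ rank G * (+ 2) ^ nullity G * Tutte G -1ℤ -1ℤ ∎
    where
    term : Subset #E → ℤ
    term A = -[1+ 1 ] ^ (r G ⊤ ℕ.∸ r G A) * -[1+ 1 ] ^ (∣ A ∣ ℕ.∸ r G A)

  -- For fixed B, the maps from A to A △ B and from C to B △ C are bijections, so the sum over B is
  -- moved outermost for the substitution and innermost afterwards. With `g` arbitrary the lemma
  -- serves both the signed count (θ) and the size of Δ (constant 1).
  ∑-conditioned : (g : Subset #E → Subset #E → Subset #E → ℤ) →
    ∑ (λ A → ∑ λ B → ∑ λ C → χ (A △ B) * χ (B △ C) * g A B C) ≡
    ∑ (λ X → ∑ λ Y → χ X * χ Y * ∑ λ B → g (X △ B) B (Y △ B))
  ∑-conditioned g = begin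
    ∑ (λ A → ∑ λ B → ∑ λ C → χ (A △ B) * χ (B △ C) * g A B C)
      ≡⟨ ∑-swap _ ⟩
    ∑ (λ B → ∑ λ A → ∑ λ C → χ (A △ B) * χ (B △ C) * g A B C)
      ≡⟨ ∑-cong (λ B → trans (∑-shift B (λ X A → ∑ λ C → χ X * χ (B △ C) * g A B C))
           (∑-cong λ X → trans
             (∑-cong λ C → cong (λ Z → χ X * χ Z * g (X △ B) B C) (△-comm B C))
             (∑-shift B (λ Y C → χ X * χ Y * g (X △ B) B C)))) ⟩
    ∑ (λ B → ∑ λ X → ∑ λ Y → χ X * χ Y * g (X △ B) B (Y △ B))
      ≡⟨ ∑-swap _ ⟩
    ∑ (λ X → ∑ λ B → ∑ λ Y → χ X * χ Y * g (X △ B) B (Y △ B))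
      ≡⟨ ∑-cong (λ X → trans (∑-swap _) (∑-cong λ Y → ∑-*ˡ (χ X * χ Y) (λ B → g (X △ B) B (Y △ B)))) ⟩
    ∑ (λ X → ∑ λ Y → χ X * χ Y * ∑ λ B → g (X △ B) B (Y △ B)) ∎

  ∑-conditioned-θ :
    ∑ (λ A → ∑ λ B → ∑ λ C → χ (A △ B) * χ (B △ C) * θ (∣ A ∣ ℕ.+ ∣ B ∣ ℕ.+ ∣ C ∣)) ≡
    eulerianPairs * R #E 0
  ∑-conditioned-θ = begin
    _ ≡⟨ ∑-conditioned (λ A B C → θ (∣ A ∣ ℕ.+ ∣ B ∣ ℕ.+ ∣ C ∣)) ⟩
    ∑ (λ X → ∑ λ Y → χ X * χ Y * ∑ λ B → θ (∣ X △ B ∣ ℕ.+ ∣ B ∣ ℕ.+ ∣ Y △ B ∣))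
      ≡⟨ ∑-cong (λ X → ∑-cong λ Y → trans (cong (χ X * χ Y *_) (∑-θ-△ X Y 0))
           (sym (*-assoc (χ X * χ Y) (sgn (X ∪ Y)) (R #E 0)))) ⟩
    ∑ (λ X → ∑ λ Y → χ X * χ Y * sgn (X ∪ Y) * R #E 0)
      ≡⟨ ∑-cong (λ X → ∑-*ʳ (R #E 0) _) ⟩
    ∑ (λ X → (∑ λ Y → χ X * χ Y * sgn (X ∪ Y)) * R #E 0)
      ≡⟨ ∑-*ʳ (R #E 0) _ ⟩
    eulerianPairs * R #E 0 ∎

  ∑-conditioned-1 : ∑ (λ A → ∑ λ B → ∑ λ C → χ (A △ B) * χ (B △ C)) ≡
                    (+ 2) ^ nullity G * (+ 2) ^ nullity G * (+ 2) ^ #E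
  ∑-conditioned-1 = begin
    ∑ (λ A → ∑ λ B → ∑ λ C → χ (A △ B) * χ (B △ C))
      ≡⟨ ∑-cong (λ A → ∑-cong λ B → ∑-cong λ C → *-identityʳ (χ (A △ B) * χ (B △ C))) ⟨
    ∑ (λ A → ∑ λ B → ∑ λ C → χ (A △ B) * χ (B △ C) * 1ℤ)
      ≡⟨ ∑-conditioned (λ _ _ _ → 1ℤ) ⟩
    ∑ (λ X → ∑ λ Y → χ X * χ Y * ∑ {#E} λ _ → 1ℤ)
      ≡⟨ ∑-cong (λ X → ∑-*ʳ (∑ {#E} λ _ → 1ℤ) (λ Y → χ X * χ Y)) ⟩
    ∑ (λ X → (∑ λ Y → χ X * χ Y) * ∑ {#E} λ _ → 1ℤ)
      ≡⟨ ∑-*ʳ (∑ {#E} λ _ → 1ℤ) (λ X → ∑ λ Y → χ X * χ Y) ⟩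
    (∑ λ X → ∑ λ Y → χ X * χ Y) * (∑ {#E} λ _ → 1ℤ)
      ≡⟨ cong₂ _*_ (∑-product χ χ) (trans (∑-const {#E} 1ℤ) (*-identityʳ _)) ⟩
    ∑ χ * ∑ χ * (+ 2) ^ #E
      ≡⟨ cong (λ z → z * z * (+ 2) ^ #E) ∑-eulerian ⟩
    (+ 2) ^ nullity G * (+ 2) ^ nullity G * (+ 2) ^ #E ∎

-- Biases

ι : ℤ → ℚ
ι i = i / 1

-- Normalised fractions do not compute on variables. Passing to unnormalised ones reduces the
-- identities for `ι` to cross-multiplication of integers.
toℚᵘ-/ : ∀ i n → ℚ.toℚᵘ (i / suc n) ℚᵘ.≃ ℚᵘ.mkℚᵘ i n
toℚᵘ-/ i n = ℚ.toℚᵘ-fromℚᵘ (ℚᵘ.mkℚᵘ i n)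

ι-* : ∀ i j → ι (i * j) ≡ ι i ℚ.* ι j
ι-* i j = ℚ.toℚᵘ-injective (ℚᵘ.≃-trans (toℚᵘ-/ (i * j) 0)
  (ℚᵘ.≃-sym (ℚᵘ.≃-trans (ℚ.toℚᵘ-homo-* (ι i) (ι j)) (ℚᵘ.*-cong (toℚᵘ-/ i 0) (toℚᵘ-/ j 0)))))

ι-injective : ∀ {i j} → ι i ≡ ι j → i ≡ j
ι-injective {i} {j} eq with ℚ./-injective-≃ (ℚᵘ.mkℚᵘ i 0) (ℚᵘ.mkℚᵘ j 0) eq
... | ℚᵘ.*≡* i≡j = *-cancelʳ-≡ i j 1ℤ i≡j

/-* : ∀ i n .{{_ : ℕ.NonZero n}} → (i / n) ℚ.* ι (+ n) ≡ ι i
/-* i (suc n) = ℚ.toℚᵘ-injective (ℚᵘ.≃-trans (ℚ.toℚᵘ-homo-* (i / suc n) (ι (+ suc n)))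
  (ℚᵘ.≃-trans (ℚᵘ.*-cong (toℚᵘ-/ i n) (toℚᵘ-/ (+ suc n) 0))
  (ℚᵘ.≃-trans (ℚᵘ.*≡* (lem i (+ suc n))) (ℚᵘ.≃-sym (toℚᵘ-/ i 0)))))
  where
  lem : ∀ i n → i * n * 1ℤ ≡ i * (n * 1ℤ)
  lem = solve-∀

ι-- : ∀ i j → ι (i - j) ≡ ι i ℚ.- ι j
ι-- i j = ℚ.toℚᵘ-injective (ℚᵘ.≃-trans (toℚᵘ-/ (i - j) 0)
  (ℚᵘ.≃-sym (ℚᵘ.≃-trans (ℚ.toℚᵘ-homo-+ (ι i) (ℚ.- ι j))
  (ℚᵘ.≃-trans (ℚᵘ.+-cong (toℚᵘ-/ i 0) (ℚᵘ.≃-trans (ℚ.toℚᵘ-homo‿- (ι j)) (ℚᵘ.-‿cong (toℚᵘ-/ j 0))))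
    (ℚᵘ.*≡* (lem i j))))))
  where
  lem : ∀ i j → (i * 1ℤ + - j * 1ℤ) * 1ℤ ≡ (i - j) * 1ℤ
  lem = solve-∀

*-cancelʳ-nonZero : ∀ p q s .{{_ : ℚ.NonZero s}} → p ℚ.* s ≡ q ℚ.* s → p ≡ q
*-cancelʳ-nonZero p q s eq = trans (sym (undo p)) (trans (cong (ℚ._* 1/ s) eq) (undo q))
  where
  undo : ∀ x → x ℚ.* s ℚ.* 1/ s ≡ x
  undo x = trans (ℚ.*-assoc x s (1/ s)) (trans (cong (x ℚ.*_) (ℚ.*-inverseʳ s)) (ℚ.*-identityʳ x))

÷-* : ∀ p s .{{_ : ℚ.NonZero s}} → (p ÷ s) ℚ.* s ≡ p
÷-* p s = trans (ℚ.*-assoc p (1/ s) s) (trans (cong (p ℚ.*_) (ℚ.*-inverseˡ s)) (ℚ.*-identityʳ p))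

*-distribʳ-- : ∀ s p q → (p ℚ.- q) ℚ.* s ≡ p ℚ.* s ℚ.- q ℚ.* s
*-distribʳ-- s p q = trans (ℚ.*-distribʳ-+ s p (ℚ.- q))
  (cong (p ℚ.* s ℚ.+_) (sym (ℚ.neg-distribˡ-* q s)))

sumList-cong : {f g : X → ℤ} → (∀ x → f x ≡ g x) → ∀ xs → sumList f xs ≡ sumList g xs
sumList-cong f≗g []       = refl
sumList-cong f≗g (x ∷ xs) = cong₂ _+_ (f≗g x) (sumList-cong f≗g xs)

sumList-- : (f g : X → ℤ) (xs : List X) →
            sumList (λ x → f x - g x) xs ≡ sumList f xs - sumList g xs
sumList-- f g []       = refl
sumList-- f g (x ∷ xs) = trans (cong (_+_ (f x - g x)) (sumList-- f g xs))
  (lem (f x) (g x) (sumList f xs) (sumList g xs))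
  where
  lem : ∀ a b c d → (a - b) + (c - d) ≡ (a + c) - (b + d)
  lem = solve-∀

module _ {Ω : Set} (xs : List Ω) .{{ne : ℕ.NonZero (length xs)}} where
  open Uniform xs

  Bias-count : {P : Pred Ω 0ℓ} (P? : Decidable P) →
    Bias P? ℚ.* ι (+ length xs) ≡ ι (sumList (λ x → ⟦ P? x ⟧ - ⟦ ¬? (P? x) ⟧) xs)
  Bias-count P? = begin
    Bias P? ℚ.* ι (+ length xs)
      ≡⟨ *-distribʳ-- (ι (+ length xs)) (ℙ P?) (ℙ (∁? P?)) ⟩
    ℙ P? ℚ.* ι (+ length xs) ℚ.- ℙ (∁? P?) ℚ.* ι (+ length xs)
      ≡⟨ cong₂ ℚ._-_ (/-* (+ length (filter P? xs)) (length xs))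
                     (/-* (+ length (filter (∁? P?) xs)) (length xs)) ⟩
    ι (+ length (filter P? xs)) ℚ.- ι (+ length (filter (∁? P?) xs))
      ≡⟨ ι-- (+ length (filter P? xs)) (+ length (filter (∁? P?) xs)) ⟨
    ι (+ length (filter P? xs) - + length (filter (∁? P?) xs))
      ≡⟨ cong ι (cong₂ _-_ (length-filter-sumList P? xs) (length-filter-sumList (∁? P?) xs)) ⟩
    ι (sumList (λ x → ⟦ P? x ⟧) xs - sumList (λ x → ⟦ ¬? (P? x) ⟧) xs)
      ≡⟨ cong ι (sumList-- (λ x → ⟦ P? x ⟧) (λ x → ⟦ ¬? (P? x) ⟧) xs) ⟨
    ι (sumList (λ x → ⟦ P? x ⟧ - ⟦ ¬? (P? x) ⟧) xs) ∎

  -- The size of the sample space cancels: multiplying by the number of outcomes in Q amounts to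
  -- multiplying by the probability of Q and then by the number of all outcomes, and each clears one
  -- denominator.
  Bias∣-count : {P Q : Pred Ω 0ℓ} (P? : Decidable P) (Q? : Decidable Q) .{{_ : ℚ.NonZero (ℙ Q?)}} →
    Bias[ P? ∣ Q? ] ℚ.* ι (sumList (λ x → ⟦ Q? x ⟧) xs) ≡
    ι (sumList (λ x → ⟦ Q? x ⟧ * (⟦ P? x ⟧ - ⟦ ¬? (P? x) ⟧)) xs)
  Bias∣-count P? Q? = begin
    Bias[ P? ∣ Q? ] ℚ.* ι (sumList (λ x → ⟦ Q? x ⟧) xs)
      ≡⟨ cong (λ i → Bias[ P? ∣ Q? ] ℚ.* ι i) (length-filter-sumList Q? xs) ⟨
    Bias[ P? ∣ Q? ] ℚ.* ι (+ length (filter Q? xs))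
      ≡⟨ cong (Bias[ P? ∣ Q? ] ℚ.*_) (/-* (+ length (filter Q? xs)) (length xs)) ⟨
    Bias[ P? ∣ Q? ] ℚ.* (ℙ Q? ℚ.* L)
      ≡⟨ ℚ.*-assoc Bias[ P? ∣ Q? ] (ℙ Q?) L ⟨
    Bias[ P? ∣ Q? ] ℚ.* ℙ Q? ℚ.* L
      ≡⟨ cong (ℚ._* L) (*-distribʳ-- (ℙ Q?) ℙ[ P? ∣ Q? ] ℙ[ ∁? P? ∣ Q? ]) ⟩
    (ℙ[ P? ∣ Q? ] ℚ.* ℙ Q? ℚ.- ℙ[ ∁? P? ∣ Q? ] ℚ.* ℙ Q?) ℚ.* L
      ≡⟨ cong₂ (λ x y → (x ℚ.- y) ℚ.* L) (÷-* (ℙ (P? ∩? Q?)) (ℙ Q?)) (÷-* (ℙ (∁? P? ∩? Q?)) (ℙ Q?)) ⟩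
    (ℙ (P? ∩? Q?) ℚ.- ℙ (∁? P? ∩? Q?)) ℚ.* L
      ≡⟨ *-distribʳ-- L (ℙ (P? ∩? Q?)) (ℙ (∁? P? ∩? Q?)) ⟩
    ℙ (P? ∩? Q?) ℚ.* L ℚ.- ℙ (∁? P? ∩? Q?) ℚ.* L
      ≡⟨ cong₂ ℚ._-_ (/-* (+ a) (length xs)) (/-* (+ b) (length xs)) ⟩
    ι (+ a) ℚ.- ι (+ b)
      ≡⟨ ι-- (+ a) (+ b) ⟨
    ι (+ a - + b)
      ≡⟨ cong ι (cong₂ _-_ (length-filter-sumList (P? ∩? Q?) xs) (length-filter-sumList (∁? P? ∩? Q?) xs)) ⟩
    ι (sumList (λ x → ⟦ (P? ∩? Q?) x ⟧) xs - sumList (λ x → ⟦ (∁? P? ∩? Q?) x ⟧) xs)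
      ≡⟨ cong ι (sumList-- (λ x → ⟦ (P? ∩? Q?) x ⟧) (λ x → ⟦ (∁? P? ∩? Q?) x ⟧) xs) ⟨
    ι (sumList (λ x → ⟦ (P? ∩? Q?) x ⟧ - ⟦ (∁? P? ∩? Q?) x ⟧) xs)
      ≡⟨ cong ι (sumList-cong (λ x → trans (cong₂ _-_ (⟦⟧-× (P? x) (Q? x)) (⟦⟧-× (¬? (P? x)) (Q? x)))
           (lem ⟦ P? x ⟧ ⟦ ¬? (P? x) ⟧ ⟦ Q? x ⟧)) xs) ⟩
    ι (sumList (λ x → ⟦ Q? x ⟧ * (⟦ P? x ⟧ - ⟦ ¬? (P? x) ⟧)) xs) ∎
    where
    L : ℚ
    L = ι (+ length xs)
    a b : ℕ
    a = length (filter (P? ∩? Q?) xs)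
    b = length (filter (∁? P? ∩? Q?) xs)
    lem : ∀ p p′ q → p * q - p′ * q ≡ q * (p - p′)
    lem = solve-∀

ι-nonZero : ∀ {i} → i ≢ 0ℤ → ℚ.NonZero (ι i)
ι-nonZero {i} i≢0 = ℚ.≢-nonZero {ι i} λ eq → i≢0 (ι-injective eq)

*-≢0 : ∀ {i j} → i ≢ 0ℤ → j ≢ 0ℤ → i * j ≢ 0ℤ
*-≢0 {i} i≢0 j≢0 eq with i*j≡0⇒i≡0∨j≡0 i eq
... | inj₁ i≡0 = i≢0 i≡0
... | inj₂ j≡0 = j≢0 j≡0

-2^≢0 : ∀ n → -[1+ 1 ] ^ n ≢ 0ℤ
-2^≢0 n eq with i^n≡0⇒i≡0 -[1+ 1 ] n eq
... | ()

module _ (G : Graph) where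
  open Graph G

  private
    cubes : ℤ
    cubes = (+ 2) ^ #E * ((+ 2) ^ #E * (+ 2) ^ #E)

    -- `W` and `D` are the sums of θ over all triples and over the triples in Δ; `cubes` and `N` are
    -- the numbers of these triples. The two biases are therefore W / cubes and D / N.
    W D N : ℤ
    W = -[1+ 1 ] ^ #E * R #E 0
    D = eulerianPairs G * R #E 0
    N = (+ 2) ^ nullity G * (+ 2) ^ nullity G * (+ 2) ^ #E

  length-triples : + length (triples #E) ≡ cubes
  length-triples = begin
    + length (triples #E)
      ≡⟨ length-sumList (triples #E) ⟩
    sumList (λ _ → 1ℤ) (triples #E)
      ≡⟨ sumList-triples {#E} (λ _ → 1ℤ) ⟩
    ∑ {#E} (λ A → ∑ {#E} λ B → ∑ {#E} λ C → 1ℤ)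
      ≡⟨ ∑-const {#E} _ ⟩
    (+ 2) ^ #E * ∑ {#E} (λ B → ∑ {#E} λ C → 1ℤ)
      ≡⟨ cong ((+ 2) ^ #E *_) (trans (∑-const {#E} _) (cong ((+ 2) ^ #E *_)
           (trans (∑-const {#E} 1ℤ) (*-identityʳ ((+ 2) ^ #E))))) ⟩
    cubes ∎

  bias-count : bias G ℚ.* ι cubes ≡ ι W
  bias-count = begin
    bias G ℚ.* ι cubes
      ≡⟨ cong (λ i → bias G ℚ.* ι i) length-triples ⟨
    bias G ℚ.* ι (+ length (triples #E))
      ≡⟨ Bias-count (triples #E) {{triples-nonEmpty #E}} (zeroOrOneMod4? G) ⟩
    ι (sumList (λ ω → ⟦ zeroOrOneMod4? G ω ⟧ - ⟦ ¬? (zeroOrOneMod4? G ω) ⟧) (triples #E))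
      ≡⟨ cong ι (sumList-triples {#E} _) ⟩
    ι (∑ λ A → ∑ λ B → ∑ λ C → ⟦ zeroOrOneMod4? G (A , B , C) ⟧ - ⟦ ¬? (zeroOrOneMod4? G (A , B , C)) ⟧)
      ≡⟨ cong ι (∑-cong λ A → ∑-cong λ B → ∑-cong λ C → θ-indicator (∣ A ∣ ℕ.+ ∣ B ∣ ℕ.+ ∣ C ∣)) ⟨
    ι (∑ {#E} λ A → ∑ {#E} λ B → ∑ {#E} λ C → θ (∣ A ∣ ℕ.+ ∣ B ∣ ℕ.+ ∣ C ∣))
      ≡⟨ cong ι (∑-θ-triples #E) ⟩
    ι W ∎

  bothEulerian-count : sumList (λ ω → ⟦ bothEulerian? G ω ⟧) (triples #E) ≡ N
  bothEulerian-count = trans (sumList-triples {#E} _) (trans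
    (∑-cong λ A → ∑-cong λ B → ∑-cong λ C → ⟦⟧-× (eulerian? G (A △ B)) (eulerian? G (B △ C)))
    (∑-conditioned-1 G))

  bias∣Δ-count : bias∣Δ G ℚ.* ι N ≡ ι D
  bias∣Δ-count = begin
    bias∣Δ G ℚ.* ι N
      ≡⟨ cong (λ i → bias∣Δ G ℚ.* ι i) bothEulerian-count ⟨
    bias∣Δ G ℚ.* ι (sumList (λ ω → ⟦ bothEulerian? G ω ⟧) (triples #E))
      ≡⟨ Bias∣-count (triples #E) {{triples-nonEmpty #E}} (zeroOrOneMod4? G) (bothEulerian? G)
           {{ℙ-bothEulerian-nonZero G}} ⟩
    ι (sumList (λ ω → ⟦ bothEulerian? G ω ⟧ *
                      (⟦ zeroOrOneMod4? G ω ⟧ - ⟦ ¬? (zeroOrOneMod4? G ω) ⟧)) (triples #E))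
      ≡⟨ cong ι (sumList-triples {#E} _) ⟩
    ι (∑ λ A → ∑ λ B → ∑ λ C → ⟦ bothEulerian? G (A , B , C) ⟧ *
        (⟦ zeroOrOneMod4? G (A , B , C) ⟧ - ⟦ ¬? (zeroOrOneMod4? G (A , B , C)) ⟧))
      ≡⟨ cong ι (∑-cong λ A → ∑-cong λ B → ∑-cong λ C → cong₂ _*_
           (⟦⟧-× (eulerian? G (A △ B)) (eulerian? G (B △ C)))
           (sym (θ-indicator (∣ A ∣ ℕ.+ ∣ B ∣ ℕ.+ ∣ C ∣)))) ⟩
    ι (∑ λ A → ∑ λ B → ∑ λ C → ⟦ eulerian? G (A △ B) ⟧ * ⟦ eulerian? G (B △ C) ⟧ *
                               θ (∣ A ∣ ℕ.+ ∣ B ∣ ℕ.+ ∣ C ∣))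
      ≡⟨ cong ι (∑-conditioned-θ G) ⟩
    ι D ∎

  ratio : ℤ
  ratio = (+ 2) ^ rank G * -1ℤ ^ nullity G * Tutte G -1ℤ -1ℤ

  -- The claimed ratio of D / N to W / cubes, cross-multiplied. `R #E 0` is a factor of both `D` and
  -- `W`, so it stays on both sides and is never divided by.
  ratio-count : D * cubes ≡ ratio * W * N
  ratio-count = begin
    D * cubes
      ≡⟨ cong₂ (λ x y → x * R #E 0 * (y * (y * y))) (eulerianPairs-Tutte G) (pow (+ 2)) ⟩
    (δ * b * T) * ρ * ((b * a) * ((b * a) * (b * a)))
      ≡⟨ lem₁ a b δ T ρ ⟩
    1ℤ * (δ * b * T * ρ * ((b * a) * ((b * a) * (b * a))))
      -- `D` carries the sign (-1) ^ rank, `ratio` the sign (-1) ^ nullity. Inserting the square of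
      -- the latter supplies the sign of `ratio`, and its other copy combines with (-1) ^ rank to
      -- the sign (-1) ^ |E| of `W`.
      ≡⟨ cong (_* (δ * b * T * ρ * ((b * a) * ((b * a) * (b * a))))) (-1^-square (nullity G)) ⟨
    (ε * ε) * (δ * b * T * ρ * ((b * a) * ((b * a) * (b * a))))
      ≡⟨ lem₂ a b ε δ T ρ ⟩
    (a * ε * T) * (((ε * δ) * (b * a)) * ρ) * (b * b * (b * a))
      ≡⟨ cong₂ (λ x y → ratio * ((x * y) * ρ) * (b * b * y)) (pow -1ℤ) (pow (+ 2)) ⟨
    ratio * ((-1ℤ ^ #E * (+ 2) ^ #E) * ρ) * N
      ≡⟨ cong (λ x → ratio * (x * ρ) * N) (-2^ #E) ⟨
    ratio * W * N ∎
    where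
    a b ε δ T ρ : ℤ
    a = (+ 2) ^ rank G
    b = (+ 2) ^ nullity G
    ε = -1ℤ ^ nullity G
    δ = -1ℤ ^ rank G
    T = Tutte G -1ℤ -1ℤ
    ρ = R #E 0
    pow : ∀ i → i ^ #E ≡ i ^ nullity G * i ^ rank G
    pow i = trans (cong (i ^_) (sym (nullity+rank G))) (^-distribˡ-+-* i (nullity G) (rank G))
    lem₁ : ∀ a b δ T ρ → (δ * b * T) * ρ * ((b * a) * ((b * a) * (b * a))) ≡
                         1ℤ * (δ * b * T * ρ * ((b * a) * ((b * a) * (b * a))))
    lem₁ = solve-∀
    lem₂ : ∀ a b ε δ T ρ → (ε * ε) * (δ * b * T * ρ * ((b * a) * ((b * a) * (b * a)))) ≡
                           (a * ε * T) * (((ε * δ) * (b * a)) * ρ) * (b * b * (b * a))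
    lem₂ = solve-∀

  N≢0 : N ≢ 0ℤ
  N≢0 = *-≢0 (*-≢0 (^-nonZero (nullity G)) (^-nonZero (nullity G))) (^-nonZero #E)

  cubes≢0 : cubes ≢ 0ℤ
  cubes≢0 = *-≢0 (^-nonZero #E) (*-≢0 (^-nonZero #E) (^-nonZero #E))

  -- As a product this covers both cases of the theorem: it gives the quotient when the bias is
  -- nonzero, and it carries the vanishing over to the conditional bias when |E| ≡ 1 (mod 4).
  bias∣Δ-bias : bias∣Δ G ≡ ι ratio ℚ.* bias G
  bias∣Δ-bias = *-cancelʳ-nonZero (bias∣Δ G) (ι ratio ℚ.* bias G) (ι N) {{ι-nonZero N≢0}}
    (*-cancelʳ-nonZero (bias∣Δ G ℚ.* ι N) (ι ratio ℚ.* bias G ℚ.* ι N) (ι cubes) {{ι-nonZero cubes≢0}} (begin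
    bias∣Δ G ℚ.* ι N ℚ.* ι cubes              ≡⟨ cong (ℚ._* ι cubes) bias∣Δ-count ⟩
    ι D ℚ.* ι cubes                           ≡⟨ ι-* D cubes ⟨
    ι (D * cubes)                             ≡⟨ cong ι ratio-count ⟩
    ι (ratio * W * N)                         ≡⟨ ι-* (ratio * W) N ⟩
    ι (ratio * W) ℚ.* ι N                     ≡⟨ cong (ℚ._* ι N) (ι-* ratio W) ⟩
    ι ratio ℚ.* ι W ℚ.* ι N                   ≡⟨ cong (λ x → ι ratio ℚ.* x ℚ.* ι N) bias-count ⟨
    ι ratio ℚ.* (bias G ℚ.* ι cubes) ℚ.* ι N  ≡⟨ cong (ℚ._* ι N) (ℚ.*-assoc (ι ratio) (bias G) (ι cubes)) ⟨
    ι ratio ℚ.* bias G ℚ.* ι cubes ℚ.* ι N    ≡⟨ *-right-comm (ι ratio ℚ.* bias G) (ι cubes) (ι N) ⟩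
    ι ratio ℚ.* bias G ℚ.* ι N ℚ.* ι cubes    ∎))
    where
    *-right-comm : ∀ x y z → x ℚ.* y ℚ.* z ≡ x ℚ.* z ℚ.* y
    *-right-comm x y z = trans (ℚ.*-assoc x y z) (trans (cong (x ℚ.*_) (ℚ.*-comm y z)) (sym (ℚ.*-assoc x z y)))

  bias-nonZero : #E % 4 ≢ 1 → ℚ.NonZero (bias G)
  bias-nonZero neq = ℚ.≢-nonZero {bias G} λ eq → *-≢0 (-2^≢0 #E) (R-nonZero #E neq)
    (ι-injective (trans (sym bias-count) (trans (cong (ℚ._* ι cubes) eq) (ℚ.*-zeroˡ (ι cubes)))))

  bias-zero : #E % 4 ≡ 1 → bias G ≡ 0ℚ
  bias-zero eq = *-cancelʳ-nonZero (bias G) 0ℚ (ι cubes) {{ι-nonZero cubes≢0}} (begin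
    bias G ℚ.* ι cubes  ≡⟨ bias-count ⟩
    ι W                 ≡⟨ cong ι (trans (cong (-[1+ 1 ] ^ #E *_) (R-zero #E eq)) (*-zeroʳ (-[1+ 1 ] ^ #E))) ⟩
    0ℚ                  ≡⟨ ℚ.*-zeroˡ (ι cubes) ⟨
    0ℚ ℚ.* ι cubes      ∎)

theorem2p19 : (G : Graph) →
    (Graph.#E G % 4 ≢ 1 →
    Σ (NonZero (bias G)) λ bias≢0 →
    _÷_ (bias∣Δ G) (bias G) {{bias≢0}}
    ≡ ((+ 2) ^ rank G * -1ℤ ^ nullity G * Tutte G -1ℤ -1ℤ) / 1)
    × (Graph.#E G % 4 ≡ 1 → bias G ≡ 0ℚ × 0ℚ ≡ bias∣Δ G)
theorem2p19 G =
  (λ neq → let bias≢0 = bias-nonZero G neq in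
    bias≢0 , *-cancelʳ-nonZero (_÷_ (bias∣Δ G) (bias G) {{bias≢0}}) (ι (ratio G)) (bias G) {{bias≢0}}
      (trans (÷-* (bias∣Δ G) (bias G) {{bias≢0}}) (bias∣Δ-bias G))) ,
  (λ eq → bias-zero G eq , sym (trans (bias∣Δ-bias G)
    (trans (cong (ι (ratio G) ℚ.*_) (bias-zero G eq)) (ℚ.*-zeroʳ (ι (ratio G))))))
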